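{- Let $G$ be a finite connected simple graph on the vertex set $[d]=\{1,\dots,d\}$ with $e$ edges and with $\delta(G) \ge 2$. Then for any real numbers $\alpha$ and $\beta$ with $2 \le \alpha \le \delta(G)$ and $\beta \ge \omega(G)$, $$c_4(G) \le \frac{(2e-\alpha d)^2}{8}\left(1-\frac{1}{\beta}\right) + \frac{e(d-\alpha^2+1)}{4} + \frac{\alpha-2}{4}\Sigma_2.$$ Moreover, $$c_4(G) = \frac{(2e-\delta(G) d)^2}{8}\left(1-\frac{1}{\omega(G)}\right) + \frac{e(d-\delta(G)^2+1)}{4} + \frac{\delta(G)-2}{4}\Sigma_2$$ holds if and only if $G$ is either the complete graph $K_d$ or the complete bipartite graph $K_{m,m}$ with $d=2m$.
   Context: $c_4(G)$ is the number of subgraphs of $G$ isomorphic to the $4$-cycle $C_4$. $\delta(G)$ is the minimum degree of $G$. $\omega(G)$ (the clique number) is the maximum number of vertices of a complete subgraph of $G$. $\Sigma_2 = \sum_{i=1}^d \deg_G(i)^2$.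
   Formalization: The parameters α and β range over the rationals instead of the real numbers. -}

module Defs where

open import Data.Bool using (Bool; true; false; if_then_else_; _xor_; _∧_)
open import Data.Nat as ℕ using (ℕ; zero; suc; _⊓_)
open import Data.Fin using (Fin; zero; suc; _<?_)
open import Data.Fin.Properties using () renaming (_≟_ to _≟ᶠ_)
open import Data.List using (List; []; _∷_; map; foldr; length; allFin)
open import Data.Nat.ListAction using (sum)
open import Data.Product using (Σ; ∃; ∃-syntax; _×_; _,_)
open import Data.Rational using (ℚ; 0ℚ; 1/_; ≢-nonZero)
open import Data.Rational.Properties using () renaming (_≟_ to _≟ℚ_)
open import Relation.Nullary using (¬_; yes; no; does)
open import Relation.Nullary.Decidable using (⌊_⌋)
open import Relation.Binary.PropositionalEquality using (_≡_; _≢_)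

-- Finite simple graphs on the vertex set Fin d  (= [d], 0-indexed)

record Graph (d : ℕ) : Set where
  field
    adj     : Fin d → Fin d → Bool
    sym     : ∀ i j → adj i j ≡ adj j i
    irrefl  : ∀ i → adj i i ≡ false
open Graph public

count : ∀ {A : Set} → (A → Bool) → List A → ℕ
count p []       = 0
count p (x ∷ xs) = if p x then suc (count p xs) else count p xs

vertices : (d : ℕ) → List (Fin d)
vertices d = allFin d

deg : ∀ {d} → Graph d → Fin d → ℕ
deg {d} G i = count (adj G i) (vertices d)

edges : ∀ {d} → Graph d → ℕ
edges {d} G =
  sum (map (λ i → count (λ j → ⌊ i <? j ⌋ ∧ adj G i j) (vertices d)) (vertices d))

sigma2 : ∀ {d} → Graph d → ℕ
sigma2 {d} G = sum (map (λ i → deg G i ℕ.* deg G i) (vertices d))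

-- minimum degree δ(G) (convention: 0 for the empty graph)
minDeg : ∀ {d} → Graph d → ℕ
minDeg {zero}  G = 0
minDeg {suc d} G = foldr _⊓_ (deg G zero) (map (deg G) (vertices (suc d)))

data Walk {d} (G : Graph d) : Fin d → Fin d → Set where
  here : ∀ {i} → Walk G i i
  step : ∀ {i j k} → adj G i j ≡ true → Walk G j k → Walk G i k

Connected : ∀ {d} → Graph d → Set
Connected {d} G = ∀ (i j : Fin d) → Walk G i j

IsClique : ∀ {d} → Graph d → List (Fin d) → Set
IsClique G xs = ∀ {i j} → Data.List.Membership.Propositional._∈_ i xs →
                          Data.List.Membership.Propositional._∈_ j xs →
                          i ≢ j → adj G i j ≡ true
  where import Data.List.Membership.Propositional

HasClique : ∀ {d} → Graph d → ℕ → Set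
HasClique G k = Σ (List _) λ xs →
  Data.List.Relation.Unary.Unique.Propositional.Unique xs × length xs ≡ k × IsClique G xs
  where import Data.List.Relation.Unary.Unique.Propositional

IsCliqueNumber : ∀ {d} → Graph d → ℕ → Set
IsCliqueNumber G w = HasClique G w × (∀ k → HasClique G k → k ℕ.≤ w)

-- c₄(G): number of subgraphs isomorphic to C₄.  Each 4-cycle a-b-c-e-a is
-- counted once via its canonical labelling: a is its least vertex and of
-- the two neighbours of a on the cycle, b < e.
c4 : ∀ {d} → Graph d → ℕ
c4 {d} G = sumOver λ a → sumOver λ b → sumOver λ c → count (isC4 a b c) (vertices d)
  where
  sumOver : (Fin d → ℕ) → ℕ
  sumOver f = sum (map f (vertices d))
  distinct : Fin d → Fin d → Bool
  distinct x y = if does (x ≟ᶠ y) then false else true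
  isC4 : Fin d → Fin d → Fin d → Fin d → Bool
  isC4 a b c e = ⌊ a <? b ⌋ ∧ ⌊ a <? c ⌋ ∧ ⌊ a <? e ⌋ ∧ ⌊ b <? e ⌋
    ∧ distinct b c ∧ distinct c e
    ∧ adj G a b ∧ adj G b c ∧ adj G c e ∧ adj G e a

IsComplete : ∀ {d} → Graph d → Set
IsComplete {d} G = ∀ (i j : Fin d) → i ≢ j → adj G i j ≡ true

-- G is isomorphic to the complete bipartite graph K_{m,m} (so d = 2m):
-- there is a bipartition into two sides of size m each, and i ~ j iff
-- i and j lie on different sides.
IsCompleteBipartiteBalanced : ∀ {d} → Graph d → ℕ → Set
IsCompleteBipartiteBalanced {d} G m =
  d ≡ 2 ℕ.* m × Σ (Fin d → Bool) λ side →
    count side (vertices d) ≡ m ×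
    (∀ i j → adj G i j ≡ side i xor side j)

-- total reciprocal on ℚ (only ever applied to positive numbers here)
recip : ℚ → ℚ
recip p with p ≟ℚ 0ℚ
... | yes _  = 0ℚ
... | no p≢0 = 1/_ p {{≢-nonZero p≢0}}

ℕtoℚ : ℕ → ℚ
ℕtoℚ n = Data.Integer.+_ n Data.Rational./ 1
  where import Data.Integer; import Data.Rational

c4Bound : ∀ {d} → Graph d → ℚ → ℚ → ℚ
c4Bound {d} G α β =
    ((two * e - α * dq) * (two * e - α * dq)) * recip (ℕtoℚ 8) * (1ℚ - recip β)
  + e * (dq - α * α + 1ℚ) * recip (ℕtoℚ 4)
  + (α - two) * recip (ℕtoℚ 4) * ℕtoℚ (sigma2 G)
  where
  open import Data.Rational using (_+_; _*_; _-_; 1ℚ)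
  two = ℕtoℚ 2
  e   = ℕtoℚ (edges G)
  dq  = ℕtoℚ d

{-# OPTIONS --safe #-}
module Submission where

-- Fix an edge uv and count the pairs (x, y) with x ∈ N(u) ∖ {v} and y ∈ N(v) ∖ {u}. There are
-- (d_u − 1)(d_v − 1) of them: the adjacent pairs (each closing a 4-cycle through uv), the common
-- neighbours x = y, and the distinct non-adjacent pairs. Inclusion–exclusion counts the common
-- neighbours as d_u + d_v + s(u,v) − d, where s(u,v) counts the vertices adjacent to neither u nor v.
-- Summing over ordered edges, every 4-cycle is counted 8 times, and
--   8 c₄ + 4 Σ₂ + R + S = Σ_{u∼v} d_u d_v + 2e (d + 1),
-- with R the non-adjacent pairs and S the common non-neighbours. For y = deg − α ≥ 0 the
-- Motzkin–Straus inequality ω · yᵀAy ≤ (ω − 1)(Σ y)² controls Σ_{u∼v} d_u d_v, which turns the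
-- bound minus c₄ into (1/8)((1 − 1/β)(Σ y)² − yᵀAy + R + S) ≥ 0. Equality forces R = S = 0: every
-- vertex sees an endpoint of every edge and the two neighbourhoods of an edge are completely
-- joined, so G is complete or complete bipartite; in the bipartite case yᵀAy = 0, hence Σ y = 0,
-- so G is regular and the two sides have equal size.

open import Defs renaming (sym to adj-sym; irrefl to adj-irrefl)
open import Algebra.Bundles using (Semiring; CommutativeRing)
import Algebra.Properties.Semiring.Sum as SemiringSum
open import Data.Bool using (Bool; true; false; if_then_else_; not; _∧_; _xor_)
import Data.Bool.Properties as Bool
open import Data.Fin using (Fin; zero; suc; _<?_)
open import Data.Fin.Properties using (_≟_; any?)
import Data.Integer as ℤ
import Data.Integer.Properties as ℤ
open import Data.List using ([]; _∷_; map; foldr; allFin; tabulate; filter; length)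
open import Data.List.Membership.Propositional using (_∈_)
open import Data.List.Membership.Propositional.Properties using (∈-allFin; ∈-filter⁻)
open import Data.List.Relation.Unary.All using ([]; _∷_)
open import Data.List.Relation.Unary.AllPairs using ([]; _∷_)
open import Data.List.Relation.Unary.Any using (here; there)
open import Data.List.Relation.Unary.Unique.Propositional.Properties using (filter⁺; allFin⁺)
open import Data.Maybe using (Maybe; just; nothing)
open import Data.Nat as ℕ using (ℕ; zero; suc; _⊓_; z≤n; s≤s) renaming (_≤_ to _≤ℕ_)
open import Data.Nat.Coprimality using (1-coprimeTo)
import Data.Nat.Coprimality as Coprime
open import Data.Nat.Induction using (<-wellFounded)
open import Data.Nat.ListAction using () renaming (sum to listSum)
import Data.Nat.Properties as ℕ
open import Data.Product using (_×_; _,_; proj₁; proj₂; ∃-syntax)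
open import Data.Rational as ℚ using (ℚ; 0ℚ; 1ℚ; mkℚ; _≤_)
import Data.Rational.Properties as ℚ
open import Data.Sum as Sum using (_⊎_; inj₁; inj₂; [_,_]′)
open import Function using (_∘_; id)
open import Function.Bundles using (_⇔_; mk⇔)
open import Induction.WellFounded using (Acc; acc)
open import Level using (0ℓ)
open import Relation.Binary.Definitions using (tri<; tri≈; tri>)
open import Relation.Binary.PropositionalEquality
  using (_≡_; _≢_; refl; sym; trans; cong; cong₂; subst; subst₂; module ≡-Reasoning)
open import Relation.Nullary using (¬_; Dec; yes; no; does; ⌊_⌋)
open import Relation.Nullary.Decidable using (¬?; _×-dec_)
open import Relation.Nullary.Negation using (contradiction)
import Tactic.RingSolver.Core.AlmostCommutativeRing as ACR

-- Finite sums and the embedding of ℕ into ℚ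

module FinSums {c ℓ} (R : Semiring c ℓ) where
  open Semiring R
    using (Carrier; _≈_; _+_; _*_; 0#; 1#; setoid; +-cong; +-congˡ; +-congʳ; +-identityˡ; +-identityʳ; *-identityʳ; zeroʳ)
    renaming (trans to ≈-trans)
  open SemiringSum R public
  open import Relation.Binary.Reasoning.Setoid setoid

  ∑-zero : ∀ {n} {f : Fin n → Carrier} → (∀ i → f i ≈ 0#) → sum f ≈ 0#
  ∑-zero {n} f≈0 = ≈-trans (sum-cong-≋ f≈0) (sum-replicate-zero n)

  ∑∑ : ∀ {m n} → (Fin m → Fin n → Carrier) → Carrier
  ∑∑ f = sum (λ x → sum (f x))

  ∑∑-cong : ∀ {m n} {f g : Fin m → Fin n → Carrier} → (∀ x y → f x y ≈ g x y) → ∑∑ f ≈ ∑∑ g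
  ∑∑-cong f≈g = sum-cong-≋ (λ x → sum-cong-≋ (f≈g x))

  ∑∑-distrib-+ : ∀ {m n} (f g : Fin m → Fin n → Carrier) → ∑∑ (λ x y → f x y + g x y) ≈ ∑∑ f + ∑∑ g
  ∑∑-distrib-+ {m} f g = ≈-trans (sum-cong-≋ {m} (λ x → ∑-distrib-+ (f x) (g x))) (∑-distrib-+ (sum ∘ f) (sum ∘ g))

  *-distribˡ-∑∑ : ∀ {m n} c (f : Fin m → Fin n → Carrier) → c * ∑∑ f ≈ ∑∑ (λ x y → c * f x y)
  *-distribˡ-∑∑ c f = ≈-trans (*-distribˡ-sum c (sum ∘ f)) (sum-cong-≋ (λ x → *-distribˡ-sum c (f x)))

  ∑*∑ : ∀ {m n} (f : Fin m → Carrier) (g : Fin n → Carrier) → sum f * sum g ≈ ∑∑ (λ x y → f x * g y)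
  ∑*∑ f g = ≈-trans (*-distribʳ-sum (sum g) f) (sum-cong-≋ (λ x → *-distribˡ-sum (f x) g))

  ∑-distrib-+₃ : ∀ {n} (f g h : Fin n → Carrier) → sum (λ x → f x + g x + h x) ≈ sum f + sum g + sum h
  ∑-distrib-+₃ f g h = ≈-trans (∑-distrib-+ (λ x → f x + g x) h) (+-congʳ (∑-distrib-+ f g))

  ∑∑-distrib-+₃ : ∀ {m n} (f g h : Fin m → Fin n → Carrier) →
                  ∑∑ (λ x y → f x y + g x y + h x y) ≈ ∑∑ f + ∑∑ g + ∑∑ h
  ∑∑-distrib-+₃ f g h = ≈-trans (∑∑-distrib-+ (λ x y → f x y + g x y) h) (+-congʳ (∑∑-distrib-+ f g))

  δ : ∀ {n} → Fin n → Fin n → Carrier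
  δ i j = if does (i ≟ j) then 1# else 0#

  δ-refl : ∀ {n} (i : Fin n) → δ i i ≡ 1#
  δ-refl i with i ≟ i
  ... | yes _   = refl
  ... | no  i≢i = contradiction refl i≢i

  δ-≢ : ∀ {n} {i j : Fin n} → i ≢ j → δ i j ≡ 0#
  δ-≢ {i = i} {j} i≢j with i ≟ j
  ... | yes i≡j = contradiction i≡j i≢j
  ... | no  _   = refl

  ∑-*δ : ∀ {n} (f : Fin n → Carrier) (u : Fin n) → sum (λ j → f j * δ j u) ≈ f u
  ∑-*δ {suc n} f zero = begin
    f zero * 1# + sum (λ j → f (suc j) * 0#) ≈⟨ +-cong (*-identityʳ _) (sum-cong-≋ (zeroʳ ∘ f ∘ suc)) ⟩
    f zero + sum {n} (λ _ → 0#)               ≈⟨ +-congˡ (sum-replicate-zero n) ⟩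
    f zero + 0#                               ≈⟨ +-identityʳ _ ⟩
    f zero                                    ∎
  ∑-*δ {suc n} f (suc u) = begin
    f zero * 0# + sum (λ j → f (suc j) * δ j u) ≈⟨ +-cong (zeroʳ (f zero)) (∑-*δ (f ∘ suc) u) ⟩
    0# + f (suc u)                              ≈⟨ +-identityˡ _ ⟩
    f (suc u)                                   ∎

cong₃ : ∀ {A B C D : Set} (f : A → B → C → D) {a a′ b b′ c c′} →
        a ≡ a′ → b ≡ b′ → c ≡ c′ → f a b c ≡ f a′ b′ c′
cong₃ f refl refl refl = refl

𝟙 : Bool → ℕ
𝟙 b = if b then 1 else 0

𝟙-∧ : ∀ a b → 𝟙 (a ∧ b) ≡ 𝟙 a ℕ.* 𝟙 b
𝟙-∧ false b = refl
𝟙-∧ true  b = sym (ℕ.+-identityʳ (𝟙 b))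

module ℕ∑ = FinSums ℕ.+-*-semiring

listSum-allFin : ∀ {n} (f : Fin n → ℕ) → listSum (map f (allFin n)) ≡ ℕ∑.sum f
listSum-allFin f = go f (λ i → i)
  where
  go : ∀ {n} {B : Set} (f : B → ℕ) (g : Fin n → B) → listSum (map f (tabulate g)) ≡ ℕ∑.sum (f ∘ g)
  go {zero}  f g = refl
  go {suc n} f g = cong (f (g zero) ℕ.+_) (go f (g ∘ suc))

count-allFin : ∀ {n} (p : Fin n → Bool) → count p (allFin n) ≡ ℕ∑.sum (𝟙 ∘ p)
count-allFin p = go p (λ i → i)
  where
  go : ∀ {n} {B : Set} (p : B → Bool) (g : Fin n → B) → count p (tabulate g) ≡ ℕ∑.sum (𝟙 ∘ p ∘ g)
  go {zero}  p g = refl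
  go {suc n} p g with p (g zero)
  ... | true  = cong suc (go p (g ∘ suc))
  ... | false = go p (g ∘ suc)

∑-const-1 : ∀ n → ℕ∑.sum {n} (λ _ → 1) ≡ n
∑-const-1 zero    = refl
∑-const-1 (suc n) = cong suc (∑-const-1 n)

∑≡0⇒≡0 : ∀ {n} (f : Fin n → ℕ) → ℕ∑.sum f ≡ 0 → ∀ i → f i ≡ 0
∑≡0⇒≡0 f eq zero    = ℕ.m+n≡0⇒m≡0 (f zero) eq
∑≡0⇒≡0 f eq (suc i) = ∑≡0⇒≡0 (f ∘ suc) (ℕ.m+n≡0⇒n≡0 (f zero) eq) i

∑-mono-≤ : ∀ {n} {f g : Fin n → ℕ} → (∀ i → f i ℕ.≤ g i) → ℕ∑.sum f ℕ.≤ ℕ∑.sum g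
∑-mono-≤ {zero}  f≤g = z≤n
∑-mono-≤ {suc n} f≤g = ℕ.+-mono-≤ (f≤g zero) (∑-mono-≤ (f≤g ∘ suc))

∑-mono-< : ∀ {n} {f g : Fin n → ℕ} → (∀ i → f i ℕ.≤ g i) → ∀ j → f j ℕ.< g j → ℕ∑.sum f ℕ.< ℕ∑.sum g
∑-mono-< f≤g zero    fj<gj = ℕ.+-mono-<-≤ fj<gj (∑-mono-≤ (f≤g ∘ suc))
∑-mono-< f≤g (suc j) fj<gj = ℕ.+-mono-≤-< (f≤g zero) (∑-mono-< (f≤g ∘ suc) j fj<gj)

∑-pos⇒pos : ∀ {n} (f : Fin n → ℕ) → 0 ℕ.< ℕ∑.sum f → ∃[ i ] 0 ℕ.< f i
∑-pos⇒pos {suc n} f pos with f zero in eq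
... | suc _ = zero , subst (0 ℕ.<_) (sym eq) (s≤s z≤n)
... | zero with ∑-pos⇒pos (f ∘ suc) pos
...   | i , fi>0 = suc i , fi>0

ringℚ : ACR.AlmostCommutativeRing 0ℓ 0ℓ
ringℚ = ACR.fromCommutativeRing ℚ.+-*-commutativeRing isZero
  where
  isZero : ∀ x → Maybe (0ℚ ≡ x)
  isZero x with 0ℚ ℚ.≟ x
  ... | yes p = just p
  ... | no _  = nothing

module ℚ∑ = FinSums (CommutativeRing.semiring ℚ.+-*-commutativeRing)

module _ where
  open import Data.Rational using (_+_; _*_; _-_; -_; _<_; _/_)
  open import Tactic.RingSolver using (solve-∀)

  ℕtoℚ≡mkℚ : ∀ n → ℕtoℚ n ≡ mkℚ (ℤ.+ n) 0 (Coprime.sym (1-coprimeTo n))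
  ℕtoℚ≡mkℚ n = ℚ.normalize-coprime (Coprime.sym (1-coprimeTo n))

  ℕtoℚ-0 : ℕtoℚ 0 ≡ 0ℚ
  ℕtoℚ-0 = ℕtoℚ≡mkℚ 0

  ℕtoℚ-1 : ℕtoℚ 1 ≡ 1ℚ
  ℕtoℚ-1 = ℕtoℚ≡mkℚ 1

  -- ℕtoℚ normalises through gcd, so ℕtoℚ ∘ 𝟙 does not compute well in conversion checking.
  𝟙ℚ : Bool → ℚ
  𝟙ℚ b = if b then 1ℚ else 0ℚ

  ℕtoℚ-𝟙 : ∀ b → ℕtoℚ (𝟙 b) ≡ 𝟙ℚ b
  ℕtoℚ-𝟙 false = ℕtoℚ-0
  ℕtoℚ-𝟙 true  = ℕtoℚ-1

  0≤𝟙ℚ : ∀ b → 0ℚ ≤ 𝟙ℚ b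
  0≤𝟙ℚ false = ℚ.≤-refl
  0≤𝟙ℚ true  = ℚ.<⇒≤ (ℚ.positive⁻¹ 1ℚ)

  ℕtoℚ-+ : ∀ m n → ℕtoℚ (m ℕ.+ n) ≡ ℕtoℚ m + ℕtoℚ n
  ℕtoℚ-+ m n rewrite ℕtoℚ≡mkℚ m | ℕtoℚ≡mkℚ n =
    sym (cong₂ (λ x y → (x ℤ.+ y) / 1) (ℤ.*-identityʳ (ℤ.+ m)) (ℤ.*-identityʳ (ℤ.+ n)))
    where import Data.Integer

  ℕtoℚ-* : ∀ m n → ℕtoℚ (m ℕ.* n) ≡ ℕtoℚ m * ℕtoℚ n
  ℕtoℚ-* m n rewrite ℕtoℚ≡mkℚ m | ℕtoℚ≡mkℚ n = cong (_/ 1) (ℤ.pos-* m n)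

  ℕtoℚ-∸ : ∀ {m n} → n ℕ.≤ m → ℕtoℚ (m ℕ.∸ n) ≡ ℕtoℚ m - ℕtoℚ n
  ℕtoℚ-∸ {m} {n} n≤m = begin
    ℕtoℚ (m ℕ.∸ n)                       ≡⟨ a≡[b+a]-b (ℕtoℚ (m ℕ.∸ n)) (ℕtoℚ n) ⟩
    ℕtoℚ n + ℕtoℚ (m ℕ.∸ n) - ℕtoℚ n      ≡⟨ cong (_- ℕtoℚ n) (sym (ℕtoℚ-+ n (m ℕ.∸ n))) ⟩
    ℕtoℚ (n ℕ.+ (m ℕ.∸ n)) - ℕtoℚ n       ≡⟨ cong (λ k → ℕtoℚ k - ℕtoℚ n) (ℕ.m+[n∸m]≡n n≤m) ⟩
    ℕtoℚ m - ℕtoℚ n                       ∎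
    where
    open ≡-Reasoning
    a≡[b+a]-b : ∀ a b → a ≡ b + a - b
    a≡[b+a]-b = solve-∀ ringℚ

  ℕtoℚ-∑ : ∀ {n} (f : Fin n → ℕ) → ℕtoℚ (ℕ∑.sum f) ≡ ℚ∑.sum (ℕtoℚ ∘ f)
  ℕtoℚ-∑ {zero}  f = refl
  ℕtoℚ-∑ {suc n} f = trans (ℕtoℚ-+ (f zero) _) (cong (ℕtoℚ (f zero) +_) (ℕtoℚ-∑ (f ∘ suc)))

  0≤ℕtoℚ : ∀ n → 0ℚ ≤ ℕtoℚ n
  0≤ℕtoℚ n rewrite ℕtoℚ≡mkℚ n = ℚ.nonNegative⁻¹ _

  0<ℕtoℚ : ∀ n → 0ℚ < ℕtoℚ (suc n)
  0<ℕtoℚ n rewrite ℕtoℚ≡mkℚ (suc n) = ℚ.positive⁻¹ _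

  ℕtoℚ-mono-≤ : ∀ {m n} → m ℕ.≤ n → ℕtoℚ m ≤ ℕtoℚ n
  ℕtoℚ-mono-≤ {m} m≤n with ℕ.m≤n⇒∃[o]m+o≡n m≤n
  ... | o , refl = subst₂ _≤_ (ℚ.+-identityʳ (ℕtoℚ m)) (sym (ℕtoℚ-+ m o)) (ℚ.+-monoʳ-≤ (ℕtoℚ m) (0≤ℕtoℚ o))

  ℕtoℚ-cancel-≤ : ∀ {m n} → ℕtoℚ m ≤ ℕtoℚ n → m ℕ.≤ n
  ℕtoℚ-cancel-≤ {m} {n} p with ℕ.≤-total m n
  ... | inj₁ m≤n = m≤n
  ... | inj₂ n≤m with ℕ.m≤n⇒∃[o]m+o≡n n≤m
  ...   | zero  , refl = ℕ.≤-reflexive (ℕ.+-identityʳ n)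
  ...   | suc o , refl = contradiction (ℚ.<-≤-trans n<n+o+1 (subst (_≤ ℕtoℚ n) (ℕtoℚ-+ n (suc o)) p)) (ℚ.<-irrefl refl)
    where
    n<n+o+1 : ℕtoℚ n < ℕtoℚ n + ℕtoℚ (suc o)
    n<n+o+1 = subst (_< ℕtoℚ n + ℕtoℚ (suc o)) (ℚ.+-identityʳ (ℕtoℚ n)) (ℚ.+-monoʳ-< (ℕtoℚ n) (0<ℕtoℚ o))

  ℕtoℚ-injective : ∀ {m n} → ℕtoℚ m ≡ ℕtoℚ n → m ≡ n
  ℕtoℚ-injective eq = ℕ.≤-antisym (ℕtoℚ-cancel-≤ (ℚ.≤-reflexive eq)) (ℕtoℚ-cancel-≤ (ℚ.≤-reflexive (sym eq)))

  +-nonNeg : ∀ {p q} → 0ℚ ≤ p → 0ℚ ≤ q → 0ℚ ≤ p + q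
  +-nonNeg = ℚ.+-mono-≤

  *-nonNeg : ∀ {p q} → 0ℚ ≤ p → 0ℚ ≤ q → 0ℚ ≤ p * q
  *-nonNeg {p} {q} 0≤p 0≤q =
    ℚ.nonNegative⁻¹ (p * q) {{ℚ.nonNeg*nonNeg⇒nonNeg p {{ℚ.nonNegative 0≤p}} q {{ℚ.nonNegative 0≤q}}}}

  square-nonNeg : ∀ p → 0ℚ ≤ p * p
  square-nonNeg p with ℚ.≤-total 0ℚ p
  ... | inj₁ 0≤p = *-nonNeg 0≤p 0≤p
  ... | inj₂ p≤0 = subst (0ℚ ≤_) (neg*neg p) (*-nonNeg 0≤-p 0≤-p)
    where
    0≤-p = ℚ.neg-antimono-≤ p≤0
    neg*neg : ∀ p → (- p) * (- p) ≡ p * p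
    neg*neg = solve-∀ ringℚ

  p≤q⇒0≤q-p : ∀ {p q} → p ≤ q → 0ℚ ≤ q - p
  p≤q⇒0≤q-p {p} {q} p≤q = subst (_≤ q - p) (ℚ.+-inverseʳ p) (ℚ.+-monoˡ-≤ (- p) p≤q)

  0≤q-p⇒p≤q : ∀ {p q} → 0ℚ ≤ q - p → p ≤ q
  0≤q-p⇒p≤q {p} {q} 0≤q-p =
    subst₂ _≤_ (ℚ.+-identityʳ p) (p+[q-p]≡q p q) (ℚ.+-monoʳ-≤ p 0≤q-p)
    where
    p+[q-p]≡q : ∀ p q → p + (q - p) ≡ q
    p+[q-p]≡q = solve-∀ ringℚ

  nonNeg+nonNeg≡0⇒≡0 : ∀ {p q} → 0ℚ ≤ p → 0ℚ ≤ q → p + q ≡ 0ℚ → p ≡ 0ℚ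
  nonNeg+nonNeg≡0⇒≡0 {p} {q} 0≤p 0≤q p+q≡0 =
    ℚ.≤-antisym (subst₂ _≤_ (ℚ.+-identityʳ p) p+q≡0 (ℚ.+-monoʳ-≤ p 0≤q)) 0≤p

  ∑-nonNeg : ∀ {n} (f : Fin n → ℚ) → (∀ i → 0ℚ ≤ f i) → 0ℚ ≤ ℚ∑.sum f
  ∑-nonNeg {zero}  f 0≤f = ℚ.≤-refl
  ∑-nonNeg {suc n} f 0≤f = +-nonNeg (0≤f zero) (∑-nonNeg (f ∘ suc) (0≤f ∘ suc))

  ∑-neg : ∀ {n} (f : Fin n → ℚ) → ℚ∑.sum (λ i → - f i) ≡ - ℚ∑.sum f
  ∑-neg {zero}  f = refl
  ∑-neg {suc n} f = trans (cong (- f zero +_) (∑-neg (f ∘ suc))) (sym (ℚ.neg-distrib-+ (f zero) _))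

  ∑-distrib-- : ∀ {n} (f g : Fin n → ℚ) → ℚ∑.sum (λ i → f i - g i) ≡ ℚ∑.sum f - ℚ∑.sum g
  ∑-distrib-- f g = trans (ℚ∑.∑-distrib-+ f (λ i → - g i)) (cong (ℚ∑.sum f +_) (∑-neg g))

  ∑-const : ∀ n (x : ℚ) → ℚ∑.sum {n} (λ _ → x) ≡ ℕtoℚ n * x
  ∑-const zero    x = sym (ℚ.*-zeroˡ x)
  ∑-const (suc n) x = begin
    x + ℚ∑.sum {n} (λ _ → x) ≡⟨ cong (x +_) (∑-const n x) ⟩
    x + ℕtoℚ n * x           ≡⟨ distrib (ℕtoℚ n) x ⟩
    (1ℚ + ℕtoℚ n) * x        ≡⟨ cong (_* x) (sym (ℕtoℚ-+ 1 n)) ⟩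
    ℕtoℚ (suc n) * x         ∎
    where
    open ≡-Reasoning
    distrib : ∀ m x → x + m * x ≡ (1ℚ + m) * x
    distrib = solve-∀ ringℚ

  recip-*-inverseˡ : ∀ p → 0ℚ < p → recip p * p ≡ 1ℚ
  recip-*-inverseˡ p 0<p with p ℚ.≟ 0ℚ
  ... | yes p≡0 = contradiction (sym p≡0) (ℚ.<⇒≢ 0<p)
  ... | no  p≢0 = ℚ.*-inverseˡ p {{ℚ.≢-nonZero p≢0}}

  recip-nonNeg : ∀ p → 0ℚ < p → 0ℚ ≤ recip p
  recip-nonNeg p 0<p with p ℚ.≟ 0ℚ
  ... | yes p≡0 = contradiction (sym p≡0) (ℚ.<⇒≢ 0<p)
  ... | no  p≢0 = ℚ.<⇒≤ (ℚ.positive⁻¹ _ {{ℚ.1/pos⇒pos p {{ℚ.positive 0<p}}}})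

  recip-antimono : ∀ p q → 0ℚ < p → p ≤ q → 0ℚ ≤ recip p - recip q
  recip-antimono p q 0<p p≤q =
    subst (0ℚ ≤_) eq (*-nonNeg (*-nonNeg (recip-nonNeg p 0<p) (recip-nonNeg q 0<q)) (p≤q⇒0≤q-p p≤q))
    where
    0<q = ℚ.<-≤-trans 0<p p≤q
    eq : (recip p * recip q) * (q - p) ≡ recip p - recip q
    eq = begin
      (recip p * recip q) * (q - p)                     ≡⟨ expand (recip p) (recip q) p q ⟩
      recip p * (recip q * q) - recip q * (recip p * p)
        ≡⟨ cong₂ (λ a b → recip p * a - recip q * b) (recip-*-inverseˡ q 0<q) (recip-*-inverseˡ p 0<p) ⟩
      recip p * 1ℚ - recip q * 1ℚ                       ≡⟨ simplify (recip p) (recip q) ⟩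
      recip p - recip q                                 ∎
      where
      open ≡-Reasoning
      expand : ∀ r s p q → (r * s) * (q - p) ≡ r * (s * q) - s * (r * p)
      expand = solve-∀ ringℚ
      simplify : ∀ r s → r * 1ℚ - s * 1ℚ ≡ r - s
      simplify = solve-∀ ringℚ

-- Degrees and edges

⌊⌋-true : ∀ {P : Set} (P? : Dec P) → P → ⌊ P? ⌋ ≡ true
⌊⌋-true (yes _) _ = refl
⌊⌋-true (no ¬p) p = contradiction p ¬p

⌊⌋-false : ∀ {P : Set} (P? : Dec P) → ¬ P → ⌊ P? ⌋ ≡ false
⌊⌋-false (yes p) ¬p = contradiction p ¬p
⌊⌋-false (no _)  _  = refl

foldr-⊓-≤ : ∀ {A : Set} (f : A → ℕ) b {xs x} → x ∈ xs → foldr _⊓_ b (map f xs) ℕ.≤ f x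
foldr-⊓-≤ f b {y ∷ ys} (here refl) = ℕ.m⊓n≤m (f y) _
foldr-⊓-≤ f b {y ∷ ys} (there x∈) = ℕ.≤-trans (ℕ.m⊓n≤n (f y) _) (foldr-⊓-≤ f b x∈)

foldr-⊓-attained : ∀ {A : Set} (f : A → ℕ) b xs → foldr _⊓_ b (map f xs) ≡ b ⊎ ∃[ x ] foldr _⊓_ b (map f xs) ≡ f x
foldr-⊓-attained f b []       = inj₁ refl
foldr-⊓-attained f b (y ∷ ys) with ℕ.⊓-sel (f y) (foldr _⊓_ b (map f ys))
... | inj₁ ≡fy   = inj₂ (y , ≡fy)
... | inj₂ ≡rest with foldr-⊓-attained f b ys
...   | inj₁ ≡b        = inj₁ (trans ≡rest ≡b)
...   | inj₂ (x , ≡fx) = inj₂ (x , trans ≡rest ≡fx)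

minDeg≤deg : ∀ {d} (G : Graph d) i → minDeg G ℕ.≤ deg G i
minDeg≤deg {suc n} G i = foldr-⊓-≤ (deg G) (deg G zero) (∈-allFin i)

minDeg-attained : ∀ {n} (G : Graph (suc n)) → ∃[ w ] minDeg G ≡ deg G w
minDeg-attained {n} G with foldr-⊓-attained (deg G) (deg G zero) (allFin (suc n))
... | inj₁ ≡deg0     = zero , ≡deg0
... | inj₂ (w , ≡dw) = w , ≡dw

adj⇒≢ : ∀ {d} (G : Graph d) {x y} → adj G x y ≡ true → x ≢ y
adj⇒≢ G {x} xy refl = contradiction (trans (sym xy) (adj-irrefl G x)) (λ ())

edge⇒clique₂ : ∀ {d} (G : Graph d) {u v} → adj G u v ≡ true → HasClique G 2
edge⇒clique₂ G {u} {v} uv = (u ∷ v ∷ []) , ((adj⇒≢ G uv ∷ []) ∷ ([] ∷ [])) , refl , clique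
  where
  clique : IsClique G (u ∷ v ∷ [])
  clique (here refl)         (here refl)         u≢u = contradiction refl u≢u
  clique (here refl)         (there (here refl)) _   = uv
  clique (there (here refl)) (here refl)         _   = trans (adj-sym G v u) uv
  clique (there (here refl)) (there (here refl)) v≢v = contradiction refl v≢v

deg>0⇒edge : ∀ {d} (G : Graph d) u → 0 ℕ.< deg G u → ∃[ v ] adj G u v ≡ true
deg>0⇒edge G u deg>0 with ∑-pos⇒pos (λ v → 𝟙 (adj G u v)) (subst (0 ℕ.<_) (count-allFin (adj G u)) deg>0)
... | v , 𝟙>0 with adj G u v in uv
...   | true = v , uv

-- Counting along edges

module Counting {d : ℕ} (G : Graph d) where
  open import Data.Fin using (_<_)
  open import Data.Fin.Properties using (<-cmp; <-asym; <-irrefl; <-trans)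
  open import Data.Nat using (_+_; _*_)
  open import Data.Nat.Tactic.RingSolver using (solve-∀)
  open ℕ∑ using (sum; sum-cong-≗; ∑-distrib-+; ∑-comm; *-distribˡ-sum; *-distribʳ-sum;
                 ∑∑; ∑∑-cong; ∑∑-distrib-+; *-distribˡ-∑∑; ∑*∑; δ; ∑-*δ; ∑-distrib-+₃; ∑∑-distrib-+₃)

  distinct : Fin d → Fin d → Bool
  distinct x y = if does (x ≟ y) then false else true

  A Aᶜ δᶜ lt : Fin d → Fin d → ℕ
  A    i j = 𝟙 (adj G i j)
  Aᶜ   i j = 𝟙 (not (adj G i j))
  δᶜ   i j = 𝟙 (distinct i j)
  lt   i j = 𝟙 ⌊ i <? j ⌋

  A-sym : ∀ i j → A i j ≡ A j i
  A-sym i j = cong 𝟙 (adj-sym G i j)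

  A-irrefl : ∀ i → A i i ≡ 0
  A-irrefl i = cong 𝟙 (adj-irrefl G i)

  δ-sym : ∀ (i j : Fin d) → δ i j ≡ δ j i
  δ-sym i j with i ≟ j | j ≟ i
  ... | yes _   | yes _   = refl
  ... | no  _   | no  _   = refl
  ... | yes i≡j | no  j≢i = contradiction (sym i≡j) j≢i
  ... | no  i≢j | yes j≡i = contradiction (sym j≡i) i≢j

  δᶜ-sym : ∀ i j → δᶜ i j ≡ δᶜ j i
  δᶜ-sym i j with i ≟ j | j ≟ i
  ... | yes _   | yes _   = refl
  ... | no  _   | no  _   = refl
  ... | yes i≡j | no  j≢i = contradiction (sym i≡j) j≢i
  ... | no  i≢j | yes j≡i = contradiction (sym j≡i) i≢j

  δᶜ+δ≡1 : ∀ i j → δᶜ i j + δ i j ≡ 1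
  δᶜ+δ≡1 i j with i ≟ j
  ... | yes _ = refl
  ... | no  _ = refl

  δᶜ*A≡A : ∀ i j → δᶜ i j * A i j ≡ A i j
  δᶜ*A≡A i j with i ≟ j
  ... | yes refl = sym (A-irrefl i)
  ... | no  _    = ℕ.+-identityʳ _

  lt*δᶜ≡lt : ∀ i j → lt i j * δᶜ i j ≡ lt i j
  lt*δᶜ≡lt i j with i ≟ j
  ... | yes refl rewrite ⌊⌋-false (i <? i) (<-irrefl refl) = refl
  ... | no  _    = ℕ.*-identityʳ _

  lt+lt≡1 : ∀ {i j} → i ≢ j → lt i j + lt j i ≡ 1
  lt+lt≡1 {i} {j} i≢j with <-cmp i j
  ... | tri< i<j _ _ rewrite ⌊⌋-true (i <? j) i<j | ⌊⌋-false (j <? i) (<-asym i<j) = refl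
  ... | tri≈ _ i≡j _ = contradiction i≡j i≢j
  ... | tri> _ _ j<i rewrite ⌊⌋-false (i <? j) (<-asym j<i) | ⌊⌋-true (j <? i) j<i = refl

  adjacent-or-equal-or-not : ∀ i j → A i j + δ i j + δᶜ i j * Aᶜ i j ≡ 1
  adjacent-or-equal-or-not i j with i ≟ j
  ... | yes refl rewrite A-irrefl i = refl
  ... | no  _ with adj G i j
  ...   | true  = refl
  ...   | false = refl

  A-split-by-< : ∀ i j → A i j ≡ lt i j * A i j + lt j i * A i j
  A-split-by-< i j with i ≟ j
  ... | yes refl rewrite A-irrefl i = sym (cong₂ _+_ (ℕ.*-zeroʳ (lt i i)) (ℕ.*-zeroʳ (lt i i)))
  ... | no  i≢j = sym (trans (sym (ℕ.*-distribʳ-+ (A i j) (lt i j) (lt j i)))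
                             (trans (cong (_* A i j) (lt+lt≡1 i≢j)) (ℕ.+-identityʳ _)))

  deg≡∑A : ∀ i → deg G i ≡ sum (A i)
  deg≡∑A i = count-allFin (adj G i)

  deg≡∑Aᵀ : ∀ i → deg G i ≡ sum (λ x → A x i)
  deg≡∑Aᵀ i = trans (deg≡∑A i) (sum-cong-≗ (λ x → A-sym i x))

  edges≡∑∑lt*A : edges G ≡ ∑∑ (λ i j → lt i j * A i j)
  edges≡∑∑lt*A = trans (listSum-allFin (λ i → count (λ j → ⌊ i <? j ⌋ ∧ adj G i j) (vertices d))) (sum-cong-≗ (λ i →
    trans (count-allFin (λ j → ⌊ i <? j ⌋ ∧ adj G i j)) (sum-cong-≗ (λ j → 𝟙-∧ ⌊ i <? j ⌋ (adj G i j)))))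

  handshake : sum (deg G) ≡ 2 * edges G
  handshake = begin
    sum (deg G)                                              ≡⟨ sum-cong-≗ deg≡∑A ⟩
    ∑∑ A                                                     ≡⟨ ∑∑-cong A-split-by-< ⟩
    ∑∑ (λ i j → lt i j * A i j + lt j i * A i j)             ≡⟨ ∑∑-distrib-+ (λ i j → lt i j * A i j) (λ i j → lt j i * A i j) ⟩
    ∑∑ (λ i j → lt i j * A i j) + ∑∑ (λ i j → lt j i * A i j)
      ≡⟨ cong (∑∑ (λ i j → lt i j * A i j) +_)
              (trans (∑-comm (λ i j → lt j i * A i j)) (∑∑-cong (λ j i → cong (lt j i *_) (A-sym i j)))) ⟩
    ∑∑ (λ i j → lt i j * A i j) + ∑∑ (λ i j → lt i j * A i j) ≡⟨ cong (λ e → e + e) (sym edges≡∑∑lt*A) ⟩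
    edges G + edges G                                        ≡⟨ cong (edges G +_) (sym (ℕ.+-identityʳ _)) ⟩
    2 * edges G                                              ∎
    where open ≡-Reasoning

  *-partition₃ : ∀ a {b c e} → b + c + e ≡ 1 → a ≡ a * b + a * c + a * e
  *-partition₃ a {b} {c} {e} b+c+e≡1 = begin
    a                     ≡⟨ sym (ℕ.*-identityʳ a) ⟩
    a * 1                 ≡⟨ cong (a *_) (sym b+c+e≡1) ⟩
    a * (b + c + e)       ≡⟨ distrib a b c e ⟩
    a * b + a * c + a * e ∎
    where
    open ≡-Reasoning
    distrib : ∀ a b c e → a * (b + c + e) ≡ a * b + a * c + a * e
    distrib = solve-∀

  N⁻ : Fin d → Fin d → Fin d → ℕ
  N⁻ u v x = A x u * δᶜ x v

  common nonNbrs adjPairs nonAdjPairs : Fin d → Fin d → ℕ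
  common      u v = sum (λ x → A x u * A x v)
  nonNbrs     u v = sum (λ x → Aᶜ x u * Aᶜ x v)
  adjPairs    u v = ∑∑ (λ x y → N⁻ u v x * N⁻ v u y * A x y)
  nonAdjPairs u v = ∑∑ (λ x y → N⁻ u v x * N⁻ v u y * (δᶜ x y * Aᶜ x y))

  ∑N⁻+1≡deg : ∀ {u v} → adj G u v ≡ true → sum (N⁻ u v) + 1 ≡ deg G u
  ∑N⁻+1≡deg {u} {v} uv = begin
    sum (N⁻ u v) + 1                                  ≡⟨ cong (sum (N⁻ u v) +_) (sym Avu≡1) ⟩
    sum (N⁻ u v) + A v u                              ≡⟨ cong (sum (N⁻ u v) +_) (sym (∑-*δ (λ x → A x u) v)) ⟩
    sum (N⁻ u v) + sum (λ x → A x u * δ x v)          ≡⟨ sym (∑-distrib-+ (N⁻ u v) (λ x → A x u * δ x v)) ⟩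
    sum (λ x → A x u * δᶜ x v + A x u * δ x v)        ≡⟨ sum-cong-≗ (λ x → sym (*-partition (A x u) (δᶜ+δ≡1 x v))) ⟩
    sum (λ x → A x u)                                 ≡⟨ sym (deg≡∑Aᵀ u) ⟩
    deg G u                                           ∎
    where
    open ≡-Reasoning
    Avu≡1 : A v u ≡ 1
    Avu≡1 = cong 𝟙 (trans (adj-sym G v u) uv)
    *-partition : ∀ a {b c} → b + c ≡ 1 → a ≡ a * b + a * c
    *-partition a {b} {c} b+c≡1 =
      trans (sym (ℕ.*-identityʳ a)) (trans (cong (a *_) (sym b+c≡1)) (ℕ.*-distribˡ-+ a b c))

  N⁻*N⁻≡A*A : ∀ u v x → N⁻ u v x * N⁻ v u x ≡ A x u * A x v
  N⁻*N⁻≡A*A u v x =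
    trans (rearrange (A x u) (δᶜ x v) (A x v) (δᶜ x u)) (cong₂ _*_ (δᶜ*A≡A x u) (δᶜ*A≡A x v))
    where
    rearrange : ∀ a b c e → a * b * (c * e) ≡ e * a * (b * c)
    rearrange = solve-∀

  ∑N⁻*∑N⁻ : ∀ u v → sum (N⁻ u v) * sum (N⁻ v u) ≡ adjPairs u v + common u v + nonAdjPairs u v
  ∑N⁻*∑N⁻ u v = begin
    sum (N⁻ u v) * sum (N⁻ v u)
      ≡⟨ ∑*∑ (N⁻ u v) (N⁻ v u) ⟩
    ∑∑ F
      ≡⟨ ∑∑-cong (λ x y → *-partition₃ (F x y) (adjacent-or-equal-or-not x y)) ⟩
    ∑∑ (λ x y → F x y * A x y + F x y * δ x y + F x y * (δᶜ x y * Aᶜ x y))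
      ≡⟨ ∑∑-distrib-+₃ (λ x y → F x y * A x y) (λ x y → F x y * δ x y) (λ x y → F x y * (δᶜ x y * Aᶜ x y)) ⟩
    adjPairs u v + ∑∑ (λ x y → F x y * δ x y) + nonAdjPairs u v
      ≡⟨ cong (λ t → adjPairs u v + t + nonAdjPairs u v) diagonal ⟩
    adjPairs u v + common u v + nonAdjPairs u v
      ∎
    where
    open ≡-Reasoning
    F : Fin d → Fin d → ℕ
    F x y = N⁻ u v x * N⁻ v u y
    diagonal : ∑∑ (λ x y → F x y * δ x y) ≡ common u v
    diagonal = sum-cong-≗ (λ x →
      trans (sum-cong-≗ (λ y → cong (F x y *_) (δ-sym x y))) (trans (∑-*δ (F x) x) (N⁻*N⁻≡A*A u v x)))

  A+A+Aᶜ*Aᶜ : ∀ u v x → A x u + A x v + Aᶜ x u * Aᶜ x v ≡ 1 + A x u * A x v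
  A+A+Aᶜ*Aᶜ u v x with adj G x u | adj G x v
  ... | true  | true  = refl
  ... | true  | false = refl
  ... | false | true  = refl
  ... | false | false = refl

  inclusion-exclusion : ∀ u v → deg G u + deg G v + nonNbrs u v ≡ d + common u v
  inclusion-exclusion u v = begin
    deg G u + deg G v + nonNbrs u v
      ≡⟨ cong₂ (λ a b → a + b + nonNbrs u v) (deg≡∑Aᵀ u) (deg≡∑Aᵀ v) ⟩
    sum (λ x → A x u) + sum (λ x → A x v) + nonNbrs u v
      ≡⟨ sym (∑-distrib-+₃ (λ x → A x u) (λ x → A x v) (λ x → Aᶜ x u * Aᶜ x v)) ⟩
    sum (λ x → A x u + A x v + Aᶜ x u * Aᶜ x v)
      ≡⟨ sum-cong-≗ (A+A+Aᶜ*Aᶜ u v) ⟩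
    sum (λ x → 1 + A x u * A x v)
      ≡⟨ ∑-distrib-+ (λ _ → 1) (λ x → A x u * A x v) ⟩
    sum {d} (λ _ → 1) + common u v
      ≡⟨ cong (_+ common u v) (∑-const-1 d) ⟩
    d + common u v
      ∎
    where open ≡-Reasoning

  slack : Fin d → Fin d → ℕ
  slack u v = nonAdjPairs u v + nonNbrs u v

  edge-identity : ∀ {u v} → adj G u v ≡ true →
                  adjPairs u v + 2 * (deg G u + deg G v) + slack u v ≡ deg G u * deg G v + (d + 1)
  edge-identity {u} {v} uv =
    arithmetic {q = adjPairs u v} {r = nonAdjPairs u v}
      (∑N⁻+1≡deg uv) (∑N⁻+1≡deg (trans (adj-sym G v u) uv)) (∑N⁻*∑N⁻ u v) (inclusion-exclusion u v)
    where
    arithmetic : ∀ {su sv du dv q t r s} → su + 1 ≡ du → sv + 1 ≡ dv →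
                 su * sv ≡ q + t + r → du + dv + s ≡ d + t →
                 q + 2 * (du + dv) + (r + s) ≡ du * dv + (d + 1)
    arithmetic {su} {sv} {q = q} {t} {r} {s} refl refl product union =
      ℕ.+-cancelʳ-≡ t _ _ (begin
        q + 2 * (su + 1 + (sv + 1)) + (r + s) + t    ≡⟨ regroup q t r s su sv ⟩
        (q + t + r) + su + sv + 2 + (su + 1 + (sv + 1) + s) ≡⟨ cong₂ (λ a b → a + su + sv + 2 + b) (sym product) union ⟩
        su * sv + su + sv + 2 + (d + t)              ≡⟨ expand su sv d t ⟩
        (su + 1) * (sv + 1) + (d + 1) + t            ∎)
      where
      open ≡-Reasoning
      regroup : ∀ q t r s su sv → q + 2 * (su + 1 + (sv + 1)) + (r + s) + t
                                ≡ (q + t + r) + su + sv + 2 + (su + 1 + (sv + 1) + s)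
      regroup = solve-∀
      expand : ∀ su sv d t → su * sv + su + sv + 2 + (d + t) ≡ (su + 1) * (sv + 1) + (d + 1) + t
      expand = solve-∀

  Vertex⁴→ℕ : Set
  Vertex⁴→ℕ = Fin d → Fin d → Fin d → Fin d → ℕ

  ∑₄ : Vertex⁴→ℕ → ℕ
  ∑₄ F = ∑∑ (λ a b → ∑∑ (F a b))

  ∑₄-cong : ∀ {F H : Vertex⁴→ℕ} → (∀ a b c e → F a b c e ≡ H a b c e) → ∑₄ F ≡ ∑₄ H
  ∑₄-cong F≡H = ∑∑-cong (λ a b → ∑∑-cong (F≡H a b))

  ∑₄-distrib-+ : ∀ (F H : Vertex⁴→ℕ) → ∑₄ (λ a b c e → F a b c e + H a b c e) ≡ ∑₄ F + ∑₄ H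
  ∑₄-distrib-+ F H = trans (∑∑-cong (λ a b → ∑∑-distrib-+ (F a b) (H a b)))
                           (∑∑-distrib-+ (λ a b → ∑∑ (F a b)) (λ a b → ∑∑ (H a b)))

  ∑₄-rotate : ∀ (F : Vertex⁴→ℕ) → ∑₄ (λ a b c e → F b c e a) ≡ ∑₄ F
  ∑₄-rotate F =
    trans (∑-comm (λ a b → ∑∑ (λ c e → F b c e a)))
          (sum-cong-≗ (λ b → trans (∑-comm (λ a c → sum (λ e → F b c e a)))
                                   (sum-cong-≗ (λ c → ∑-comm (λ a e → F b c e a)))))

  ∑₄-reflect : ∀ (F : Vertex⁴→ℕ) → ∑₄ (λ a b c e → F a e c b) ≡ ∑₄ F
  ∑₄-reflect F = sum-cong-≗ (λ a →
    trans (∑-comm (λ b c → sum (λ e → F a e c b)))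
          (trans (sum-cong-≗ (λ c → ∑-comm (λ b e → F a e c b)))
                 (∑-comm (λ c e → sum (λ b → F a e c b)))))

  cyc : Vertex⁴→ℕ
  cyc a b c e = A a b * A b c * A c e * A e a * δᶜ a c * δᶜ b e

  ∑edges : (Fin d → Fin d → ℕ) → ℕ
  ∑edges f = ∑∑ (λ u v → A u v * f u v)

  ∑edges-adjPairs≡∑₄cyc : ∑edges adjPairs ≡ ∑₄ cyc
  ∑edges-adjPairs≡∑₄cyc = begin
    ∑edges adjPairs
      ≡⟨ ∑∑-cong (λ u v → *-distribˡ-∑∑ (A u v) (λ x y → N⁻ u v x * N⁻ v u y * A x y)) ⟩
    ∑∑ (λ u v → ∑∑ (λ x y → A u v * (N⁻ u v x * N⁻ v u y * A x y)))
      ≡⟨ ∑₄-cong path≡cyc ⟩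
    ∑∑ (λ u v → ∑∑ (λ x y → cyc x u v y))
      ≡⟨ sum-cong-≗ (λ u → ∑-comm (λ v x → sum (λ y → cyc x u v y))) ⟩
    sum (λ u → ∑∑ (λ x v → sum (λ y → cyc x u v y)))
      ≡⟨ ∑-comm (λ u x → ∑∑ (λ v y → cyc x u v y)) ⟩
    ∑₄ cyc
      ∎
    where
    open ≡-Reasoning
    rearrange : ∀ Auv Axu δxv Ayv δyu Axy →
                Auv * (Axu * δxv * (Ayv * δyu) * Axy) ≡ Axu * Auv * Ayv * Axy * δxv * δyu
    rearrange = solve-∀
    path≡cyc : ∀ u v x y → A u v * (N⁻ u v x * N⁻ v u y * A x y) ≡ cyc x u v y
    path≡cyc u v x y = trans (rearrange (A u v) (A x u) (δᶜ x v) (A y v) (δᶜ y u) (A x y))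
      (cong₃ (λ a b c → A x u * A u v * a * b * δᶜ x v * c) (A-sym y v) (A-sym x y) (δᶜ-sym y u))

  Distinct₄ : Fin d → Fin d → Fin d → Fin d → Set
  Distinct₄ a b c e = a ≢ b × b ≢ c × c ≢ e × e ≢ a × a ≢ c × b ≢ e

  ≢⇒distinct : ∀ {x y} → x ≢ y → distinct x y ≡ true
  ≢⇒distinct {x} {y} x≢y with x ≟ y
  ... | yes x≡y = contradiction x≡y x≢y
  ... | no  _   = refl

  distinct⇒≢ : ∀ {x y} → distinct x y ≡ true → x ≢ y
  distinct⇒≢ {x} {y} ne with x ≟ y
  ... | no x≢y = x≢y

  cyc≡0⊎cyc≡1 : ∀ a b c e → cyc a b c e ≡ 0 ⊎ (cyc a b c e ≡ 1 × Distinct₄ a b c e)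
  cyc≡0⊎cyc≡1 a b c e
    with adj G a b in ab | adj G b c in bc | adj G c e in ce | adj G e a in ea
       | distinct a c in ac | distinct b e in be
  ... | true | true | true | true | true | true =
    inj₂ (refl , adj⇒≢ G ab , adj⇒≢ G bc , adj⇒≢ G ce , adj⇒≢ G ea , distinct⇒≢ ac , distinct⇒≢ be)
  ... | false | _     | _     | _     | _     | _     = inj₁ refl
  ... | true  | false | _     | _     | _     | _     = inj₁ refl
  ... | true  | true  | false | _     | _     | _     = inj₁ (ℕ.*-zeroʳ (1 * 1))
  ... | true  | true  | true  | false | _     | _     = inj₁ refl
  ... | true  | true  | true  | true  | false | _     = inj₁ refl
  ... | true  | true  | true  | true  | true  | false = inj₁ refl

  cyc-rotate : ∀ a b c e → cyc b c e a ≡ cyc a b c e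
  cyc-rotate a b c e = trans (cong (A b c * A c e * A e a * A a b * δᶜ b e *_) (δᶜ-sym c a))
                             (rearrange (A a b) (A b c) (A c e) (A e a) (δᶜ a c) (δᶜ b e))
    where
    rearrange : ∀ x₁ x₂ x₃ x₄ x₅ x₆ → x₂ * x₃ * x₄ * x₁ * x₆ * x₅ ≡ x₁ * x₂ * x₃ * x₄ * x₅ * x₆
    rearrange = solve-∀

  cyc-reflect : ∀ a b c e → cyc a e c b ≡ cyc a b c e
  cyc-reflect a b c e =
    trans (cong₃ (λ x y z → x * y * A c b * A b a * δᶜ a c * z) (A-sym a e) (A-sym e c) (δᶜ-sym e b))
          (trans (cong₂ (λ x y → A e a * A c e * x * y * δᶜ a c * δᶜ b e) (A-sym c b) (A-sym b a))
                 (rearrange (A a b) (A b c) (A c e) (A e a) (δᶜ a c) (δᶜ b e)))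
    where
    rearrange : ∀ x₁ x₂ x₃ x₄ x₅ x₆ → x₄ * x₃ * x₂ * x₁ * x₅ * x₆ ≡ x₁ * x₂ * x₃ * x₄ * x₅ * x₆
    rearrange = solve-∀

  -- A 4-cycle has 8 labellings a-b-c-e (4 rotations, 2 reflections); c4 counts the one with a least and b < e.
  least : Vertex⁴→ℕ
  least a b c e = lt a b * lt a c * lt a e

  Least : Fin d → Fin d → Fin d → Fin d → Set
  Least a b c e = a < b × a < c × a < e

  ∑rotations-least : Vertex⁴→ℕ
  ∑rotations-least a b c e = least a b c e + least b c e a + least c e a b + least e a b c

  ∑rotations-least-rotate : ∀ a b c e → ∑rotations-least b c e a ≡ ∑rotations-least a b c e
  ∑rotations-least-rotate a b c e = rotate (least b c e a) (least c e a b) (least e a b c) (least a b c e)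
    where
    rotate : ∀ x y z w → x + y + z + w ≡ w + x + y + z
    rotate = solve-∀

  Least⇒∑rotations-least≡1 : ∀ {a b c e} → Least a b c e → ∑rotations-least a b c e ≡ 1
  Least⇒∑rotations-least≡1 {a} {b} {c} {e} (a<b , a<c , a<e)
    rewrite ⌊⌋-true (a <? b) a<b | ⌊⌋-true (a <? c) a<c | ⌊⌋-true (a <? e) a<e
          | ⌊⌋-false (b <? a) (<-asym a<b) | ⌊⌋-false (c <? a) (<-asym a<c) | ⌊⌋-false (e <? a) (<-asym a<e)
    = simplify (lt b c * lt b e) (lt c e) (lt c b) (lt e b * lt e c)
    where
    simplify : ∀ x y z w → 1 * 1 * 1 + x * 0 + y * 0 * z + 0 * w ≡ 1
    simplify = solve-∀

  <-or-> : ∀ {x y : Fin d} → x ≢ y → x < y ⊎ y < x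
  <-or-> {x} {y} x≢y with <-cmp x y
  ... | tri< x<y _ _ = inj₁ x<y
  ... | tri≈ _ x≡y _ = contradiction x≡y x≢y
  ... | tri> _ _ y<x = inj₂ y<x

  some-rotation-Least : ∀ {a b c e} → Distinct₄ a b c e →
                        Least a b c e ⊎ Least b c e a ⊎ Least c e a b ⊎ Least e a b c
  some-rotation-Least (a≢b , b≢c , c≢e , e≢a , a≢c , b≢e) with <-or-> a≢b | <-or-> c≢e
  ... | inj₁ a<b | inj₁ c<e with <-or-> a≢c
  ...   | inj₁ a<c = inj₁ (a<b , a<c , <-trans a<c c<e)
  ...   | inj₂ c<a = inj₂ (inj₂ (inj₁ (c<e , c<a , <-trans c<a a<b)))
  some-rotation-Least (a≢b , b≢c , c≢e , e≢a , a≢c , b≢e) | inj₁ a<b | inj₂ e<c with <-or-> (e≢a ∘ sym)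
  ...   | inj₁ a<e = inj₁ (a<b , <-trans a<e e<c , a<e)
  ...   | inj₂ e<a = inj₂ (inj₂ (inj₂ (e<a , <-trans e<a a<b , e<c)))
  some-rotation-Least (a≢b , b≢c , c≢e , e≢a , a≢c , b≢e) | inj₂ b<a | inj₁ c<e with <-or-> b≢c
  ...   | inj₁ b<c = inj₂ (inj₁ (b<c , <-trans b<c c<e , b<a))
  ...   | inj₂ c<b = inj₂ (inj₂ (inj₁ (c<e , <-trans c<b b<a , c<b)))
  some-rotation-Least (a≢b , b≢c , c≢e , e≢a , a≢c , b≢e) | inj₂ b<a | inj₂ e<c with <-or-> b≢e
  ...   | inj₁ b<e = inj₂ (inj₁ (<-trans b<e e<c , b<e , b<a))
  ...   | inj₂ e<b = inj₂ (inj₂ (inj₂ (<-trans e<b b<a , e<b , e<c)))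

  Distinct₄⇒∑rotations-least≡1 : ∀ {a b c e} → Distinct₄ a b c e → ∑rotations-least a b c e ≡ 1
  Distinct₄⇒∑rotations-least≡1 {a} {b} {c} {e} distinct with some-rotation-Least distinct
  ... | inj₁ least-a = Least⇒∑rotations-least≡1 least-a
  ... | inj₂ (inj₁ least-b) =
    trans (sym (∑rotations-least-rotate a b c e)) (Least⇒∑rotations-least≡1 least-b)
  ... | inj₂ (inj₂ (inj₁ least-c)) =
    trans (sym (trans (∑rotations-least-rotate b c e a) (∑rotations-least-rotate a b c e)))
          (Least⇒∑rotations-least≡1 least-c)
  ... | inj₂ (inj₂ (inj₂ least-e)) =
    trans (∑rotations-least-rotate e a b c) (Least⇒∑rotations-least≡1 least-e)

  *-congʳ-unless-0 : ∀ {x y c} → c ≡ 0 ⊎ x ≡ y → x * c ≡ y * c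
  *-congʳ-unless-0 {x} {y} (inj₁ refl) = trans (ℕ.*-zeroʳ x) (sym (ℕ.*-zeroʳ y))
  *-congʳ-unless-0         (inj₂ refl) = refl

  least·cyc : Vertex⁴→ℕ
  least·cyc a b c e = least a b c e * cyc a b c e

  cyc≡∑rotations-least·cyc : ∀ a b c e →
    cyc a b c e ≡ least·cyc a b c e + least·cyc b c e a + least·cyc c e a b + least·cyc e a b c
  cyc≡∑rotations-least·cyc a b c e = begin
    cyc a b c e
      ≡⟨ sym (ℕ.*-identityˡ C) ⟩
    1 * C
      ≡⟨ *-congʳ-unless-0 (Sum.map₂ (sym ∘ Distinct₄⇒∑rotations-least≡1 ∘ proj₂) (cyc≡0⊎cyc≡1 a b c e)) ⟩
    ∑rotations-least a b c e * cyc a b c e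
      ≡⟨ ℕ.*-distribʳ-+ _ (least a b c e + least b c e a + least c e a b) (least e a b c) ⟩
    (least a b c e + least b c e a + least c e a b) * C + least e a b c * C
      ≡⟨ cong (_+ least e a b c * C) (ℕ.*-distribʳ-+ _ (least a b c e + least b c e a) (least c e a b)) ⟩
    (least a b c e + least b c e a) * C + least c e a b * C + least e a b c * C
      ≡⟨ cong (λ x → x + least c e a b * C + least e a b c * C) (ℕ.*-distribʳ-+ _ (least a b c e) (least b c e a)) ⟩
    least a b c e * C + least b c e a * C + least c e a b * C + least e a b c * C
      ≡⟨ cong₃ (λ x y z → least a b c e * C + least b c e a * x + least c e a b * y + least e a b c * z)
               (sym (cyc-rotate a b c e))
               (sym (trans (cyc-rotate b c e a) (cyc-rotate a b c e)))
               (cyc-rotate e a b c) ⟩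
    least·cyc a b c e + least·cyc b c e a + least·cyc c e a b + least·cyc e a b c
      ∎
    where
    open ≡-Reasoning
    C = cyc a b c e

  ∑₄cyc≡4*∑₄least·cyc : ∑₄ cyc ≡ 4 * ∑₄ least·cyc
  ∑₄cyc≡4*∑₄least·cyc = begin
    ∑₄ cyc
      ≡⟨ ∑₄-cong cyc≡∑rotations-least·cyc ⟩
    ∑₄ (λ a b c e → L a b c e + L b c e a + L c e a b + L e a b c)
      ≡⟨ ∑₄-distrib-+ (λ a b c e → L a b c e + L b c e a + L c e a b) (λ a b c e → L e a b c) ⟩
    ∑₄ (λ a b c e → L a b c e + L b c e a + L c e a b) + ∑₄ (λ a b c e → L e a b c)
      ≡⟨ cong (_+ ∑₄ (λ a b c e → L e a b c)) (∑₄-distrib-+ (λ a b c e → L a b c e + L b c e a) (λ a b c e → L c e a b)) ⟩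
    ∑₄ (λ a b c e → L a b c e + L b c e a) + ∑₄ (λ a b c e → L c e a b) + ∑₄ (λ a b c e → L e a b c)
      ≡⟨ cong (λ x → x + ∑₄ (λ a b c e → L c e a b) + ∑₄ (λ a b c e → L e a b c)) (∑₄-distrib-+ L (λ a b c e → L b c e a)) ⟩
    ∑₄ L + ∑₄ (λ a b c e → L b c e a) + ∑₄ (λ a b c e → L c e a b) + ∑₄ (λ a b c e → L e a b c)
      ≡⟨ cong₃ (λ x y z → ∑₄ L + x + y + z) rotate¹ rotate² rotate³ ⟩
    ∑₄ L + ∑₄ L + ∑₄ L + ∑₄ L
      ≡⟨ times4 (∑₄ L) ⟩
    4 * ∑₄ L
      ∎
    where
    open ≡-Reasoning
    L = least·cyc
    rotate¹ : ∑₄ (λ a b c e → L b c e a) ≡ ∑₄ L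
    rotate¹ = ∑₄-rotate L
    rotate² : ∑₄ (λ a b c e → L c e a b) ≡ ∑₄ L
    rotate² = trans (∑₄-rotate (λ a b c e → L b c e a)) rotate¹
    rotate³ : ∑₄ (λ a b c e → L e a b c) ≡ ∑₄ L
    rotate³ = trans (∑₄-rotate (λ a b c e → L c e a b)) rotate²
    times4 : ∀ x → x + x + x + x ≡ 4 * x
    times4 = solve-∀

  canonical : Vertex⁴→ℕ
  canonical a b c e = least a b c e * lt b e * cyc a b c e

  least·cyc≡canonical+canonical : ∀ a b c e → least·cyc a b c e ≡ canonical a b c e + canonical a e c b
  least·cyc≡canonical+canonical a b c e = begin
    least a b c e * C
      ≡⟨ *-congʳ-unless-0 (Sum.map₂ split-least (cyc≡0⊎cyc≡1 a b c e)) ⟩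
    (least a b c e * lt b e + least a e c b * lt e b) * C
      ≡⟨ ℕ.*-distribʳ-+ C (least a b c e * lt b e) (least a e c b * lt e b) ⟩
    least a b c e * lt b e * C + least a e c b * lt e b * C
      ≡⟨ cong (λ x → least a b c e * lt b e * C + least a e c b * lt e b * x) (sym (cyc-reflect a b c e)) ⟩
    canonical a b c e + canonical a e c b
      ∎
    where
    open ≡-Reasoning
    C = cyc a b c e
    split : ∀ x y z p q → p + q ≡ 1 → x * y * z ≡ x * y * z * p + z * y * x * q
    split x y z p q p+q≡1 = trans (sym (ℕ.*-identityʳ (x * y * z)))
                                  (trans (cong (x * y * z *_) (sym p+q≡1)) (distrib x y z p q))
      where
      distrib : ∀ x y z p q → x * y * z * (p + q) ≡ x * y * z * p + z * y * x * q
      distrib = solve-∀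
    split-least : C ≡ 1 × Distinct₄ a b c e → least a b c e ≡ least a b c e * lt b e + least a e c b * lt e b
    split-least (_ , (_ , _ , _ , _ , _ , b≢e)) = split (lt a b) (lt a c) (lt a e) (lt b e) (lt e b) (lt+lt≡1 b≢e)

  ∑₄least·cyc≡2*∑₄canonical : ∑₄ least·cyc ≡ 2 * ∑₄ canonical
  ∑₄least·cyc≡2*∑₄canonical = begin
    ∑₄ least·cyc                                                    ≡⟨ ∑₄-cong least·cyc≡canonical+canonical ⟩
    ∑₄ (λ a b c e → canonical a b c e + canonical a e c b)          ≡⟨ ∑₄-distrib-+ canonical (λ a b c e → canonical a e c b) ⟩
    ∑₄ canonical + ∑₄ (λ a b c e → canonical a e c b)               ≡⟨ cong (∑₄ canonical +_) (∑₄-reflect canonical) ⟩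
    ∑₄ canonical + ∑₄ canonical                                     ≡⟨ cong (∑₄ canonical +_) (sym (ℕ.+-identityʳ _)) ⟩
    2 * ∑₄ canonical                                                ∎
    where open ≡-Reasoning

  isC4 : Fin d → Fin d → Fin d → Fin d → Bool
  isC4 a b c e = ⌊ a <? b ⌋ ∧ ⌊ a <? c ⌋ ∧ ⌊ a <? e ⌋ ∧ ⌊ b <? e ⌋
    ∧ distinct b c ∧ distinct c e
    ∧ adj G a b ∧ adj G b c ∧ adj G c e ∧ adj G e a

  c4≡∑₄isC4 : c4 G ≡ ∑₄ (λ a b c e → 𝟙 (isC4 a b c e))
  c4≡∑₄isC4 =
    trans (listSum-allFin (λ a → sumOver λ b → sumOver λ c → count (isC4 a b c) (vertices d))) (sum-cong-≗ λ a →
    trans (listSum-allFin (λ b → sumOver λ c → count (isC4 a b c) (vertices d))) (sum-cong-≗ λ b →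
    trans (listSum-allFin (λ c → count (isC4 a b c) (vertices d))) (sum-cong-≗ λ c →
    count-allFin (isC4 a b c))))
    where
    sumOver : (Fin d → ℕ) → ℕ
    sumOver f = listSum (map f (vertices d))

  𝟙isC4≡canonical : ∀ a b c e → 𝟙 (isC4 a b c e) ≡ canonical a b c e
  𝟙isC4≡canonical a b c e = begin
    𝟙 (isC4 a b c e)
      ≡⟨ 𝟙-∧-cong ⌊ a <? b ⌋ (𝟙-∧-cong ⌊ a <? c ⌋ (𝟙-∧-cong ⌊ a <? e ⌋ (𝟙-∧-cong ⌊ b <? e ⌋
         (𝟙-∧-cong (distinct b c) (𝟙-∧-cong (distinct c e) (𝟙-∧-cong (adj G a b) (𝟙-∧-cong (adj G b c)
         (𝟙-∧ (adj G c e) (adj G e a))))))))) ⟩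
    lt a b * (lt a c * (lt a e * (lt b e * (δᶜ b c * (δᶜ c e * (A a b * (A b c * (A c e * A e a))))))))
      ≡⟨ regroup (lt a b) (lt a c) (lt a e) (lt b e) (δᶜ b c) (δᶜ c e) (A a b) (A b c) (A c e) (A e a) ⟩
    lt a b * lt a c * lt a e * lt b e * A a b * A e a * (δᶜ b c * A b c) * (δᶜ c e * A c e)
      ≡⟨ cong₂ (λ x y → lt a b * lt a c * lt a e * lt b e * A a b * A e a * x * y) (δᶜ*A≡A b c) (δᶜ*A≡A c e) ⟩
    lt a b * lt a c * lt a e * lt b e * A a b * A e a * A b c * A c e
      ≡⟨ cong₂ (λ x y → lt a b * x * lt a e * y * A a b * A e a * A b c * A c e) (sym (lt*δᶜ≡lt a c)) (sym (lt*δᶜ≡lt b e)) ⟩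
    lt a b * (lt a c * δᶜ a c) * lt a e * (lt b e * δᶜ b e) * A a b * A e a * A b c * A c e
      ≡⟨ regroup′ (lt a b) (lt a c) (δᶜ a c) (lt a e) (lt b e) (δᶜ b e) (A a b) (A e a) (A b c) (A c e) ⟩
    canonical a b c e
      ∎
    where
    open ≡-Reasoning
    𝟙-∧-cong : ∀ x {y m} → 𝟙 y ≡ m → 𝟙 (x ∧ y) ≡ 𝟙 x * m
    𝟙-∧-cong x {y} eq = trans (𝟙-∧ x y) (cong (𝟙 x *_) eq)
    regroup : ∀ x₁ x₂ x₃ x₄ x₅ x₆ x₇ x₈ x₉ x₁₀ →
              x₁ * (x₂ * (x₃ * (x₄ * (x₅ * (x₆ * (x₇ * (x₈ * (x₉ * x₁₀))))))))
              ≡ x₁ * x₂ * x₃ * x₄ * x₇ * x₁₀ * (x₅ * x₈) * (x₆ * x₉)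
    regroup = solve-∀
    regroup′ : ∀ ab ac δac ae be δbe Aab Aea Abc Ace →
               ab * (ac * δac) * ae * (be * δbe) * Aab * Aea * Abc * Ace
               ≡ ab * ac * ae * be * (Aab * Abc * Ace * Aea * δac * δbe)
    regroup′ = solve-∀

  ∑edges-adjPairs≡8*c4 : ∑edges adjPairs ≡ 8 * c4 G
  ∑edges-adjPairs≡8*c4 = begin
    ∑edges adjPairs           ≡⟨ ∑edges-adjPairs≡∑₄cyc ⟩
    ∑₄ cyc                    ≡⟨ ∑₄cyc≡4*∑₄least·cyc ⟩
    4 * ∑₄ least·cyc          ≡⟨ cong (4 *_) ∑₄least·cyc≡2*∑₄canonical ⟩
    4 * (2 * ∑₄ canonical)    ≡⟨ cong (λ x → 4 * (2 * x)) (sym (trans c4≡∑₄isC4 (∑₄-cong 𝟙isC4≡canonical))) ⟩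
    4 * (2 * c4 G)            ≡⟨ sym (ℕ.*-assoc 4 2 (c4 G)) ⟩
    8 * c4 G                  ∎
    where open ≡-Reasoning

  ∑edges-distrib-+ : ∀ f g → ∑edges (λ u v → f u v + g u v) ≡ ∑edges f + ∑edges g
  ∑edges-distrib-+ f g = trans (∑∑-cong (λ u v → ℕ.*-distribˡ-+ (A u v) (f u v) (g u v)))
                               (∑∑-distrib-+ (λ u v → A u v * f u v) (λ u v → A u v * g u v))

  ∑edges-*ˡ : ∀ c f → ∑edges (λ u v → c * f u v) ≡ c * ∑edges f
  ∑edges-*ˡ c f = trans (∑∑-cong (λ u v → swap (A u v) c (f u v)))
                        (sym (*-distribˡ-∑∑ c (λ u v → A u v * f u v)))
    where
    swap : ∀ a c x → a * (c * x) ≡ c * (a * x)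
    swap = solve-∀

  ∑edges-deg+deg : ∑edges (λ u v → deg G u + deg G v) ≡ 2 * sigma2 G
  ∑edges-deg+deg = begin
    ∑edges (λ u v → deg G u + deg G v)
      ≡⟨ ∑edges-distrib-+ (λ u _ → deg G u) (λ _ v → deg G v) ⟩
    ∑edges (λ u _ → deg G u) + ∑edges (λ _ v → deg G v)
      ≡⟨ cong (∑edges (λ u _ → deg G u) +_) (trans (∑-comm (λ u v → A u v * deg G v))
                                                   (∑∑-cong (λ v u → cong (_* deg G v) (A-sym u v)))) ⟩
    ∑edges (λ u _ → deg G u) + ∑edges (λ u _ → deg G u)
      ≡⟨ cong (λ x → x + x) ∑edges-deg ⟩
    sigma2 G + sigma2 G
      ≡⟨ cong (sigma2 G +_) (sym (ℕ.+-identityʳ _)) ⟩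
    2 * sigma2 G
      ∎
    where
    open ≡-Reasoning
    ∑edges-deg : ∑edges (λ u _ → deg G u) ≡ sigma2 G
    ∑edges-deg = trans (sum-cong-≗ (λ u → trans (sym (*-distribʳ-sum (deg G u) (A u)))
                                               (cong (_* deg G u) (sym (deg≡∑A u)))))
                       (sym (listSum-allFin (λ u → deg G u * deg G u)))

  ∑edges-const : ∀ c → ∑edges (λ _ _ → c) ≡ c * (2 * edges G)
  ∑edges-const c = begin
    ∑∑ (λ u v → A u v * c)     ≡⟨ ∑∑-cong (λ u v → ℕ.*-comm (A u v) c) ⟩
    ∑∑ (λ u v → c * A u v)     ≡⟨ sym (*-distribˡ-∑∑ c A) ⟩
    c * ∑∑ A                   ≡⟨ cong (c *_) (trans (sym (sum-cong-≗ deg≡∑A)) handshake) ⟩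
    c * (2 * edges G)          ∎
    where open ≡-Reasoning

  Slack M : ℕ
  Slack = ∑edges slack
  M     = ∑edges (λ u v → deg G u * deg G v)

  counting-identity : 8 * c4 G + 4 * sigma2 G + Slack ≡ M + (d + 1) * (2 * edges G)
  counting-identity = begin
    8 * c4 G + 4 * sigma2 G + Slack
      ≡⟨ cong₂ (λ x y → x + y + Slack) (sym ∑edges-adjPairs≡8*c4)
               (trans (ℕ.*-assoc 2 2 (sigma2 G)) (cong (2 *_) (sym ∑edges-deg+deg))) ⟩
    ∑edges adjPairs + 2 * ∑edges (λ u v → deg G u + deg G v) + Slack
      ≡⟨ cong (λ x → ∑edges adjPairs + x + Slack) (sym (∑edges-*ˡ 2 (λ u v → deg G u + deg G v))) ⟩
    ∑edges adjPairs + ∑edges (λ u v → 2 * (deg G u + deg G v)) + Slack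
      ≡⟨ cong (_+ Slack) (sym (∑edges-distrib-+ adjPairs (λ u v → 2 * (deg G u + deg G v)))) ⟩
    ∑edges (λ u v → adjPairs u v + 2 * (deg G u + deg G v)) + Slack
      ≡⟨ sym (∑edges-distrib-+ (λ u v → adjPairs u v + 2 * (deg G u + deg G v)) slack) ⟩
    ∑edges (λ u v → adjPairs u v + 2 * (deg G u + deg G v) + slack u v)
      ≡⟨ ∑∑-cong edge-identity-or-no-edge ⟩
    ∑edges (λ u v → deg G u * deg G v + (d + 1))
      ≡⟨ ∑edges-distrib-+ (λ u v → deg G u * deg G v) (λ _ _ → d + 1) ⟩
    M + ∑edges (λ _ _ → d + 1)
      ≡⟨ cong (M +_) (∑edges-const (d + 1)) ⟩
    M + (d + 1) * (2 * edges G)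
      ∎
    where
    open ≡-Reasoning
    edge-identity-or-no-edge : ∀ u v → A u v * (adjPairs u v + 2 * (deg G u + deg G v) + slack u v)
                                     ≡ A u v * (deg G u * deg G v + (d + 1))
    edge-identity-or-no-edge u v with adj G u v in uv
    ... | true  = cong (1 *_) (edge-identity uv)
    ... | false = refl

length-filter≡count : ∀ {A : Set} {P : A → Set} (P? : ∀ x → Dec (P x)) xs →
                      length (filter P? xs) ≡ count (λ x → ⌊ P? x ⌋) xs
length-filter≡count P? [] = refl
length-filter≡count P? (x ∷ xs) with P? x
... | yes _ = cong suc (length-filter≡count P? xs)
... | no  _ = length-filter≡count P? xs

-- The Motzkin–Straus inequality

module MotzkinStraus {d : ℕ} (G : Graph d) (ω : ℕ) (ω-bounds-cliques : ∀ k → HasClique G k → k ℕ.≤ ω) where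
  open ℚ∑ using (sum; sum-cong-≗; ∑-distrib-+; ∑-comm; *-distribˡ-sum; *-distribʳ-sum;
                 ∑∑; ∑∑-cong; ∑∑-distrib-+; ∑∑-distrib-+₃; *-distribˡ-∑∑; δ; δ-refl; δ-≢; ∑-*δ)
  open import Data.Rational using (_+_; _*_; _-_; -_)
  open import Tactic.RingSolver using (solve-∀)

  Aℚ : Fin d → Fin d → ℚ
  Aℚ i j = 𝟙ℚ (adj G i j)

  Aℚ-sym : ∀ i j → Aℚ i j ≡ Aℚ j i
  Aℚ-sym i j = cong 𝟙ℚ (adj-sym G i j)

  Aℚ-irrefl : ∀ i → Aℚ i i ≡ 0ℚ
  Aℚ-irrefl i = cong 𝟙ℚ (adj-irrefl G i)

  infix 7 _·A·_
  _·A·_ : (Fin d → ℚ) → (Fin d → ℚ) → ℚ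
  f ·A· g = ∑∑ (λ k l → Aℚ k l * (f k * g l))

  A· : (Fin d → ℚ) → Fin d → ℚ
  A· g k = sum (λ l → Aℚ k l * g l)

  ·A·-sym : ∀ f g → f ·A· g ≡ g ·A· f
  ·A·-sym f g = trans (∑-comm (λ k l → Aℚ k l * (f k * g l)))
                      (∑∑-cong (λ l k → cong₂ _*_ (Aℚ-sym k l) (ℚ.*-comm (f k) (g l))))

  ·A·≡∑*A· : ∀ f g → f ·A· g ≡ sum (λ k → f k * A· g k)
  ·A·≡∑*A· f g = sum-cong-≗ (λ k →
    trans (sum-cong-≗ (λ l → swap (Aℚ k l) (f k) (g l))) (sym (*-distribˡ-sum (f k) (λ l → Aℚ k l * g l))))
    where
    swap : ∀ a x y → a * (x * y) ≡ x * (a * y)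
    swap = solve-∀ ringℚ

  NonNeg : (Fin d → ℚ) → Set
  NonNeg y = ∀ i → 0ℚ ≤ y i

  MotzkinStrausBound : (Fin d → ℚ) → Set
  MotzkinStrausBound y = ℕtoℚ ω * (y ·A· y) ≤ (ℕtoℚ ω - 1ℚ) * (sum y * sum y)

  _≢0? : ∀ x → Dec (x ≢ 0ℚ)
  x ≢0? = ¬? (x ℚ.≟ 0ℚ)

  supportSize : (Fin d → ℚ) → ℕ
  supportSize y = ℕ∑.sum (λ i → 𝟙 ⌊ y i ≢0? ⌋)

  SupportIsClique : (Fin d → ℚ) → Set
  SupportIsClique y = ∀ {i j} → y i ≢ 0ℚ → y j ≢ 0ℚ → i ≢ j → adj G i j ≡ true

  supportSize≤ω : ∀ y → SupportIsClique y → supportSize y ℕ.≤ ω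
  supportSize≤ω y clique =
    subst (ℕ._≤ ω) length≡supportSize (ω-bounds-cliques _ (support , filter⁺ P? (allFin⁺ d) , refl , isClique))
    where
    P? = λ i → y i ≢0?
    support = filter P? (allFin d)
    length≡supportSize : length support ≡ supportSize y
    length≡supportSize = trans (length-filter≡count P? (allFin d)) (count-allFin (λ i → ⌊ P? i ⌋))
    isClique : IsClique G support
    isClique i∈ j∈ i≢j =
      clique (proj₂ (∈-filter⁻ P? {xs = allFin d} i∈)) (proj₂ (∈-filter⁻ P? {xs = allFin d} j∈)) i≢j

  ·A·-on-clique : ∀ y → SupportIsClique y → y ·A· y ≡ sum y * sum y - sum (λ k → y k * y k)
  ·A·-on-clique y clique = begin
    y ·A· y                                        ≡⟨ ∑∑-cong pointwise ⟩
    ∑∑ (λ k l → y k * y l - y k * y l * δ l k)     ≡⟨ sum-cong-≗ row ⟩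
    sum (λ k → y k * sum y - y k * y k)            ≡⟨ ∑-distrib-- (λ k → y k * sum y) (λ k → y k * y k) ⟩
    sum (λ k → y k * sum y) - sum (λ k → y k * y k) ≡⟨ cong (_- sum (λ k → y k * y k)) (sym (*-distribʳ-sum (sum y) y)) ⟩
    sum y * sum y - sum (λ k → y k * y k)          ∎
    where
    open ≡-Reasoning
    x-x*1≡0 : ∀ x → x - x * 1ℚ ≡ 0ℚ
    x-x*1≡0 = solve-∀ ringℚ
    x-x*0≡x : ∀ x → x - x * 0ℚ ≡ x
    x-x*0≡x = solve-∀ ringℚ
    a*x≡x-if-x≡0 : ∀ {a x} → x ≡ 0ℚ → a * x ≡ x
    a*x≡x-if-x≡0 {a} refl = ℚ.*-zeroʳ a
    A*yy≡yy : ∀ {k l} → l ≢ k → Aℚ k l * (y k * y l) ≡ y k * y l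
    A*yy≡yy {k} {l} l≢k with y k ℚ.≟ 0ℚ | y l ℚ.≟ 0ℚ
    ... | yes yk≡0 | _        = a*x≡x-if-x≡0 {Aℚ k l} (trans (cong (_* y l) yk≡0) (ℚ.*-zeroˡ (y l)))
    ... | no _     | yes yl≡0 = a*x≡x-if-x≡0 {Aℚ k l} (trans (cong (y k *_) yl≡0) (ℚ.*-zeroʳ (y k)))
    ... | no yk≢0 | no yl≢0 =
      trans (cong (λ b → 𝟙ℚ b * (y k * y l)) (clique yk≢0 yl≢0 (l≢k ∘ sym))) (ℚ.*-identityˡ _)
    pointwise : ∀ k l → Aℚ k l * (y k * y l) ≡ y k * y l - y k * y l * δ l k
    pointwise k l with l ≟ k
    ... | yes refl = trans (cong (_* (y k * y k)) (Aℚ-irrefl k))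
                           (trans (ℚ.*-zeroˡ (y k * y k)) (sym (x-x*1≡0 (y k * y k))))
    ... | no  l≢k  = trans (A*yy≡yy l≢k) (sym (x-x*0≡x (y k * y l)))
    row : ∀ k → sum (λ l → y k * y l - y k * y l * δ l k) ≡ y k * sum y - y k * y k
    row k = trans (∑-distrib-- (λ l → y k * y l) (λ l → y k * y l * δ l k))
                  (cong₂ _-_ (sym (*-distribˡ-sum (y k) y)) (∑-*δ (λ l → y k * y l) k))

  cauchy-schwarz-on-support : ∀ y → sum y * sum y ≤ ℕtoℚ (supportSize y) * sum (λ k → y k * y k)
  cauchy-schwarz-on-support y =
    0≤q-p⇒p≤q (ℚ.*-cancelˡ-≤-pos (ℕtoℚ 2) (subst₂ _≤_ (sym (ℚ.*-zeroʳ (ℕtoℚ 2))) W≡2*[KT-S²] 0≤W))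
    where
    open ≡-Reasoning
    S T K : ℚ
    S = sum y
    T = sum (λ k → y k * y k)
    K = ℕtoℚ (supportSize y)
    c : Fin d → ℚ
    c k = 𝟙ℚ ⌊ y k ≢0? ⌋
    ∑c≡K : sum c ≡ K
    ∑c≡K = sym (trans (ℕtoℚ-∑ (λ k → 𝟙 ⌊ y k ≢0? ⌋)) (sum-cong-≗ (λ k → ℕtoℚ-𝟙 ⌊ y k ≢0? ⌋)))
    c*y≡y : ∀ k → c k * y k ≡ y k
    c*y≡y k with y k ℚ.≟ 0ℚ
    ... | yes yk≡0 = trans (ℚ.*-zeroˡ (y k)) (sym yk≡0)
    ... | no  _    = ℚ.*-identityˡ (y k)
    W : ℚ
    W = ∑∑ (λ k l → c k * c l * ((y k - y l) * (y k - y l)))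
    0≤W : 0ℚ ≤ W
    0≤c : ∀ k → 0ℚ ≤ c k
    0≤c k = 0≤𝟙ℚ ⌊ y k ≢0? ⌋
    0≤W = ∑-nonNeg _ (λ k → ∑-nonNeg (λ l → c k * c l * ((y k - y l) * (y k - y l))) (λ l →
            *-nonNeg (*-nonNeg (0≤c k) (0≤c l)) (square-nonNeg (y k - y l))))
    expand : ∀ ck cl yk yl → ck * cl * ((yk - yl) * (yk - yl))
                             ≡ cl * ((ck * yk) * yk) + ck * ((cl * yl) * yl) - ℕtoℚ 2 * ((ck * yk) * (cl * yl))
    expand = solve-∀ ringℚ
    pointwise : ∀ k l → c k * c l * ((y k - y l) * (y k - y l))
                        ≡ c l * (y k * y k) + c k * (y l * y l) - ℕtoℚ 2 * (y k * y l)
    pointwise k l = trans (expand (c k) (c l) (y k) (y l))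
      (cong₂ (λ a b → c l * (a * y k) + c k * (b * y l) - ℕtoℚ 2 * (a * b)) (c*y≡y k) (c*y≡y l))
    ∑-linear₃ : ∀ (f g h : Fin d → ℚ) → sum (λ k → f k + g k - h k) ≡ sum f + sum g - sum h
    ∑-linear₃ f g h = trans (∑-distrib-- (λ k → f k + g k) h) (cong (_- sum h) (∑-distrib-+ f g))
    row : ∀ k → sum (λ l → c l * (y k * y k) + c k * (y l * y l) - ℕtoℚ 2 * (y k * y l))
                ≡ K * (y k * y k) + c k * T - ℕtoℚ 2 * (y k * S)
    row k = trans (∑-linear₃ (λ l → c l * (y k * y k)) (λ l → c k * (y l * y l)) (λ l → ℕtoℚ 2 * (y k * y l)))
      (cong₃ (λ a b e → a + b - e)
             (trans (sym (*-distribʳ-sum (y k * y k) c)) (cong (_* (y k * y k)) ∑c≡K))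
             (sym (*-distribˡ-sum (c k) (λ l → y l * y l)))
             (trans (sym (*-distribˡ-sum (ℕtoℚ 2) (λ l → y k * y l))) (cong (ℕtoℚ 2 *_) (sym (*-distribˡ-sum (y k) y)))))
    W≡2*[KT-S²] : W ≡ ℕtoℚ 2 * (K * T - S * S)
    W≡2*[KT-S²] = begin
      W ≡⟨ sum-cong-≗ (λ k → trans (sum-cong-≗ (pointwise k)) (row k)) ⟩
      sum (λ k → K * (y k * y k) + c k * T - ℕtoℚ 2 * (y k * S))
        ≡⟨ ∑-linear₃ (λ k → K * (y k * y k)) (λ k → c k * T) (λ k → ℕtoℚ 2 * (y k * S)) ⟩
      sum (λ k → K * (y k * y k)) + sum (λ k → c k * T) - sum (λ k → ℕtoℚ 2 * (y k * S))
        ≡⟨ cong₃ (λ a b e → a + b - e)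
                 (sym (*-distribˡ-sum K (λ k → y k * y k)))
                 (trans (sym (*-distribʳ-sum T c)) (cong (_* T) ∑c≡K))
                 (trans (sym (*-distribˡ-sum (ℕtoℚ 2) (λ k → y k * S))) (cong (ℕtoℚ 2 *_) (sym (*-distribʳ-sum S y)))) ⟩
      K * T + K * T - ℕtoℚ 2 * (S * S)
        ≡⟨ collect K T S ⟩
      ℕtoℚ 2 * (K * T - S * S) ∎
      where
      collect : ∀ k t s → k * t + k * t - ℕtoℚ 2 * (s * s) ≡ ℕtoℚ 2 * (k * t - s * s)
      collect = solve-∀ ringℚ

  bound-on-clique : ∀ y → SupportIsClique y → MotzkinStrausBound y
  bound-on-clique y clique = 0≤q-p⇒p≤q (subst (0ℚ ≤_) (sym difference) (p≤q⇒0≤q-p S²≤ωT))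
    where
    S T : ℚ
    S = sum y
    T = sum (λ k → y k * y k)
    S²≤ωT : S * S ≤ ℕtoℚ ω * T
    S²≤ωT = ℚ.≤-trans (cauchy-schwarz-on-support y)
                      (ℚ.*-monoʳ-≤-nonNeg T {{ℚ.nonNegative (∑-nonNeg _ (λ k → square-nonNeg (y k)))}}
                                           (ℕtoℚ-mono-≤ (supportSize≤ω y clique)))
    rearrange : ∀ w s t → (w - 1ℚ) * (s * s) - w * (s * s - t) ≡ w * t - s * s
    rearrange = solve-∀ ringℚ
    difference : (ℕtoℚ ω - 1ℚ) * (S * S) - ℕtoℚ ω * (y ·A· y) ≡ ℕtoℚ ω * T - S * S
    difference = trans (cong (λ q → (ℕtoℚ ω - 1ℚ) * (S * S) - ℕtoℚ ω * q) (·A·-on-clique y clique))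
                       (rearrange (ℕtoℚ ω) S T)

  ·A·-expand : ∀ y h c → (λ l → y l + c * h l) ·A· (λ l → y l + c * h l)
                         ≡ y ·A· y + c * (h ·A· y + y ·A· h) + c * c * (h ·A· h)
  ·A·-expand y h c = begin
    ∑∑ (λ k l → Aℚ k l * ((y k + c * h k) * (y l + c * h l)))
      ≡⟨ ∑∑-cong (λ k l → expand (Aℚ k l) (y k) (y l) (h k) (h l) c) ⟩
    ∑∑ (λ k l → Aℚ k l * (y k * y l) + c * (Aℚ k l * (h k * y l) + Aℚ k l * (y k * h l))
                + c * c * (Aℚ k l * (h k * h l)))
      ≡⟨ ∑∑-distrib-+₃ (λ k l → Aℚ k l * (y k * y l))
                       (λ k l → c * (Aℚ k l * (h k * y l) + Aℚ k l * (y k * h l)))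
                       (λ k l → c * c * (Aℚ k l * (h k * h l))) ⟩
    y ·A· y + ∑∑ (λ k l → c * (Aℚ k l * (h k * y l) + Aℚ k l * (y k * h l))) + ∑∑ (λ k l → c * c * (Aℚ k l * (h k * h l)))
      ≡⟨ cong₂ (λ a b → y ·A· y + a + b)
               (trans (sym (*-distribˡ-∑∑ c (λ k l → Aℚ k l * (h k * y l) + Aℚ k l * (y k * h l))))
                      (cong (c *_) (∑∑-distrib-+ (λ k l → Aℚ k l * (h k * y l)) (λ k l → Aℚ k l * (y k * h l)))))
               (sym (*-distribˡ-∑∑ (c * c) (λ k l → Aℚ k l * (h k * h l)))) ⟩
    y ·A· y + c * (h ·A· y + y ·A· h) + c * c * (h ·A· h)
      ∎
    where
    open ≡-Reasoning
    expand : ∀ a yk yl hk hl c → a * ((yk + c * hk) * (yl + c * hl))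
             ≡ a * (yk * yl) + c * (a * (hk * yl) + a * (yk * hl)) + c * c * (a * (hk * hl))
    expand = solve-∀ ringℚ

  e[_-_] : Fin d → Fin d → Fin d → ℚ
  e[ i - j ] l = δ l i - δ l j

  ∑-*e : ∀ f i j → sum (λ l → f l * e[ i - j ] l) ≡ f i - f j
  ∑-*e f i j = trans (sum-cong-≗ (λ l → distrib (f l) (δ l i) (δ l j)))
                     (trans (∑-distrib-- (λ l → f l * δ l i) (λ l → f l * δ l j))
                            (cong₂ _-_ (∑-*δ f i) (∑-*δ f j)))
    where
    distrib : ∀ a x y → a * (x - y) ≡ a * x - a * y
    distrib = solve-∀ ringℚ

  e·A· : ∀ i j g → e[ i - j ] ·A· g ≡ A· g i - A· g j
  e·A· i j g = trans (·A·≡∑*A· e[ i - j ] g)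
                     (trans (sum-cong-≗ (λ k → ℚ.*-comm (e[ i - j ] k) (A· g k))) (∑-*e (A· g) i j))

  e·A·e : ∀ {i j} → adj G i j ≡ false → e[ i - j ] ·A· e[ i - j ] ≡ 0ℚ
  e·A·e {i} {j} ij = begin
    e[ i - j ] ·A· e[ i - j ]               ≡⟨ e·A· i j e[ i - j ] ⟩
    A· e[ i - j ] i - A· e[ i - j ] j       ≡⟨ cong₂ _-_ (∑-*e (Aℚ i) i j) (∑-*e (Aℚ j) i j) ⟩
    (Aℚ i i - Aℚ i j) - (Aℚ j i - Aℚ j j)   ≡⟨ cong₂ (λ a b → (a - Aℚ i j) - (Aℚ j i - b)) (Aℚ-irrefl i) (Aℚ-irrefl j) ⟩
    (0ℚ - Aℚ i j) - (Aℚ j i - 0ℚ)           ≡⟨ cong₂ (λ a b → (0ℚ - a) - (b - 0ℚ)) Aij≡0 (trans (Aℚ-sym j i) Aij≡0) ⟩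
    (0ℚ - 0ℚ) - (0ℚ - 0ℚ)                   ≡⟨⟩
    0ℚ                                      ∎
    where
    open ≡-Reasoning
    Aij≡0 : Aℚ i j ≡ 0ℚ
    Aij≡0 = cong 𝟙ℚ ij

  moveWeight : (Fin d → ℚ) → Fin d → Fin d → Fin d → ℚ
  moveWeight y i j l = y l + y j * e[ i - j ] l

  sum-moveWeight : ∀ y i j → sum (moveWeight y i j) ≡ sum y
  sum-moveWeight y i j = begin
    sum (moveWeight y i j)                     ≡⟨ ∑-distrib-+ y (λ l → y j * e[ i - j ] l) ⟩
    sum y + sum (λ l → y j * e[ i - j ] l)     ≡⟨ cong (sum y +_) (sym (*-distribˡ-sum (y j) e[ i - j ])) ⟩
    sum y + y j * sum e[ i - j ]               ≡⟨ cong (λ s → sum y + y j * s) ∑e≡0 ⟩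
    sum y + y j * 0ℚ                           ≡⟨ cong (sum y +_) (ℚ.*-zeroʳ (y j)) ⟩
    sum y + 0ℚ                                 ≡⟨ ℚ.+-identityʳ (sum y) ⟩
    sum y                                      ∎
    where
    open ≡-Reasoning
    ∑e≡0 : sum e[ i - j ] ≡ 0ℚ
    ∑e≡0 = trans (sum-cong-≗ (λ l → sym (ℚ.*-identityˡ (e[ i - j ] l)))) (∑-*e (λ _ → 1ℚ) i j)

  moveWeight-·A· : ∀ y {i j} → adj G i j ≡ false →
                   moveWeight y i j ·A· moveWeight y i j ≡ y ·A· y + y j * ((A· y i - A· y j) + (A· y i - A· y j))
  moveWeight-·A· y {i} {j} ij = begin
    moveWeight y i j ·A· moveWeight y i j
      ≡⟨ ·A·-expand y e[ i - j ] (y j) ⟩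
    y ·A· y + y j * (e[ i - j ] ·A· y + y ·A· e[ i - j ]) + y j * y j * (e[ i - j ] ·A· e[ i - j ])
      ≡⟨ cong₃ (λ a b c → y ·A· y + y j * (a + b) + y j * y j * c)
               (e·A· i j y) (trans (·A·-sym y e[ i - j ]) (e·A· i j y)) (e·A·e ij) ⟩
    y ·A· y + y j * ((A· y i - A· y j) + (A· y i - A· y j)) + y j * y j * 0ℚ
      ≡⟨ drop (y ·A· y) (y j) (A· y i - A· y j) ⟩
    y ·A· y + y j * ((A· y i - A· y j) + (A· y i - A· y j))
      ∎
    where
    open ≡-Reasoning
    drop : ∀ q c t → q + c * (t + t) + c * c * 0ℚ ≡ q + c * (t + t)
    drop = solve-∀ ringℚ

  moveWeight-at-i : ∀ y {i j} → i ≢ j → moveWeight y i j i ≡ y i + y j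
  moveWeight-at-i y {i} {j} i≢j =
    trans (cong₂ (λ a b → y i + y j * (a - b)) (δ-refl i) (δ-≢ i≢j)) (simplify (y i) (y j))
    where
    simplify : ∀ a c → a + c * (1ℚ - 0ℚ) ≡ a + c
    simplify = solve-∀ ringℚ

  moveWeight-at-j : ∀ y {i j} → i ≢ j → moveWeight y i j j ≡ 0ℚ
  moveWeight-at-j y {i} {j} i≢j =
    trans (cong₂ (λ a b → y j + y j * (a - b)) (δ-≢ (i≢j ∘ sym)) (δ-refl j)) (simplify (y j))
    where
    simplify : ∀ a → a + a * (0ℚ - 1ℚ) ≡ 0ℚ
    simplify = solve-∀ ringℚ

  moveWeight-elsewhere : ∀ y {i j l} → l ≢ i → l ≢ j → moveWeight y i j l ≡ y l
  moveWeight-elsewhere y {i} {j} {l} l≢i l≢j =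
    trans (cong₂ (λ a b → y l + y j * (a - b)) (δ-≢ l≢i) (δ-≢ l≢j)) (simplify (y l) (y j))
    where
    simplify : ∀ a c → a + c * (0ℚ - 0ℚ) ≡ a
    simplify = solve-∀ ringℚ

  NonAdjacentInSupport : (Fin d → ℚ) → Fin d → Fin d → Set
  NonAdjacentInSupport y i j = y i ≢ 0ℚ × y j ≢ 0ℚ × i ≢ j × adj G i j ≡ false

  nonAdjacentInSupport? : ∀ y i j → Dec (NonAdjacentInSupport y i j)
  nonAdjacentInSupport? y i j = y i ≢0? ×-dec y j ≢0? ×-dec ¬? (i ≟ j) ×-dec (adj G i j Bool.≟ false)

  NonNeg-moveWeight : ∀ {y i j} → NonNeg y → i ≢ j → NonNeg (moveWeight y i j)
  NonNeg-moveWeight {y} {i} {j} y≥0 i≢j l = at (l ≟ i) (l ≟ j)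
    where
    at : Dec (l ≡ i) → Dec (l ≡ j) → 0ℚ ≤ moveWeight y i j l
    at (yes refl) _          = subst (0ℚ ≤_) (sym (moveWeight-at-i y i≢j)) (+-nonNeg (y≥0 i) (y≥0 j))
    at (no _)     (yes refl) = ℚ.≤-reflexive (sym (moveWeight-at-j y i≢j))
    at (no l≢i)   (no l≢j)   = subst (0ℚ ≤_) (sym (moveWeight-elsewhere y l≢i l≢j)) (y≥0 l)

  supportSize-moveWeight : ∀ {y i j} → NonAdjacentInSupport y i j → supportSize (moveWeight y i j) ℕ.< supportSize y
  supportSize-moveWeight {y} {i} {j} (yi≢0 , yj≢0 , i≢j , _) =
    ∑-mono-< shrinks j (subst (𝟙 ⌊ moveWeight y i j j ≢0? ⌋ ℕ.<_) (sym (indicator-≡1 yj≢0)) (s≤s shrinks-at-j))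
    where
    indicator-≤1 : ∀ x → 𝟙 ⌊ x ≢0? ⌋ ℕ.≤ 1
    indicator-≤1 x with x ℚ.≟ 0ℚ
    ... | yes _ = z≤n
    ... | no  _ = s≤s z≤n
    indicator-≡1 : ∀ {x} → x ≢ 0ℚ → 𝟙 ⌊ x ≢0? ⌋ ≡ 1
    indicator-≡1 {x} x≢0 with x ℚ.≟ 0ℚ
    ... | yes x≡0 = contradiction x≡0 x≢0
    ... | no  _   = refl
    shrinks-at-j : 𝟙 ⌊ moveWeight y i j j ≢0? ⌋ ℕ.≤ 0
    shrinks-at-j = ℕ.≤-reflexive (cong (λ x → 𝟙 ⌊ x ≢0? ⌋) (moveWeight-at-j y i≢j))
    shrinks : ∀ l → 𝟙 ⌊ moveWeight y i j l ≢0? ⌋ ℕ.≤ 𝟙 ⌊ y l ≢0? ⌋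
    shrinks l = at (l ≟ i) (l ≟ j)
      where
      at : Dec (l ≡ i) → Dec (l ≡ j) → 𝟙 ⌊ moveWeight y i j l ≢0? ⌋ ℕ.≤ 𝟙 ⌊ y l ≢0? ⌋
      at (yes refl) _          =
        subst (𝟙 ⌊ moveWeight y i j i ≢0? ⌋ ℕ.≤_) (sym (indicator-≡1 yi≢0)) (indicator-≤1 (moveWeight y i j i))
      at (no _)     (yes refl) = ℕ.≤-trans shrinks-at-j z≤n
      at (no l≢i)   (no l≢j)   = ℕ.≤-reflexive (cong (λ x → 𝟙 ⌊ x ≢0? ⌋) (moveWeight-elsewhere y l≢i l≢j))

  bound-from-moveWeight : ∀ {y i j} → NonNeg y → NonAdjacentInSupport y i j → A· y j ≤ A· y i →
                       MotzkinStrausBound (moveWeight y i j) → MotzkinStrausBound y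
  bound-from-moveWeight {y} {i} {j} y≥0 (_ , _ , _ , ij) Ayj≤Ayi bound = ℚ.≤-trans ω·yAy≤ω·y′Ay′
    (subst (λ s → ℕtoℚ ω * (moveWeight y i j ·A· moveWeight y i j) ≤ (ℕtoℚ ω - 1ℚ) * (s * s))
           (sum-moveWeight y i j) bound)
    where
    0≤gain : 0ℚ ≤ y j * ((A· y i - A· y j) + (A· y i - A· y j))
    0≤gain = *-nonNeg (y≥0 j) (+-nonNeg (p≤q⇒0≤q-p Ayj≤Ayi) (p≤q⇒0≤q-p Ayj≤Ayi))
    yAy≤y′Ay′ : y ·A· y ≤ moveWeight y i j ·A· moveWeight y i j
    yAy≤y′Ay′ = subst₂ _≤_ (ℚ.+-identityʳ (y ·A· y)) (sym (moveWeight-·A· y ij)) (ℚ.+-monoʳ-≤ (y ·A· y) 0≤gain)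
    ω·yAy≤ω·y′Ay′ : ℕtoℚ ω * (y ·A· y) ≤ ℕtoℚ ω * (moveWeight y i j ·A· moveWeight y i j)
    ω·yAy≤ω·y′Ay′ = ℚ.*-monoˡ-≤-nonNeg (ℕtoℚ ω) {{ℚ.nonNegative (0≤ℕtoℚ ω)}} yAy≤y′Ay′

  -- Moving the weight of one vertex of a non-adjacent pair in the support onto the other (the one with
  -- larger Ay) does not decrease yᵀAy and shrinks the support; on a clique the bound is Cauchy–Schwarz.
  motzkin-straus : ∀ y → NonNeg y → MotzkinStrausBound y
  motzkin-straus y y≥0 = go y y≥0 (<-wellFounded (supportSize y))
    where
    go : ∀ y → NonNeg y → Acc ℕ._<_ (supportSize y) → MotzkinStrausBound y
    go y y≥0 (acc smaller) with any? (λ i → any? (λ j → nonAdjacentInSupport? y i j))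
    ... | no none = bound-on-clique y clique
      where
      clique : SupportIsClique y
      clique {i} {j} yi≢0 yj≢0 i≢j with adj G i j in ij
      ... | true  = refl
      ... | false = contradiction (i , j , yi≢0 , yj≢0 , i≢j , ij) none
    ... | yes (i , j , bad@(yi≢0 , yj≢0 , i≢j , ij)) with ℚ.≤-total (A· y j) (A· y i)
    ...   | inj₁ Ayj≤Ayi = bound-from-moveWeight y≥0 bad Ayj≤Ayi
                             (go _ (NonNeg-moveWeight y≥0 i≢j) (smaller (supportSize-moveWeight bad)))
    ...   | inj₂ Ayi≤Ayj = bound-from-moveWeight y≥0 bad′ Ayi≤Ayj
                             (go _ (NonNeg-moveWeight y≥0 (i≢j ∘ sym)) (smaller (supportSize-moveWeight bad′)))
      where
      bad′ : NonAdjacentInSupport y j i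
      bad′ = yj≢0 , yi≢0 , i≢j ∘ sym , trans (adj-sym G j i) ij

-- Graphs attaining the bound

EdgesDominate : ∀ {d} → Graph d → Set
EdgesDominate {d} G = ∀ {u v} → adj G u v ≡ true → ∀ w → adj G w u ≡ true ⊎ adj G w v ≡ true

EdgeNeighbourhoodsAdjacent : ∀ {d} → Graph d → Set
EdgeNeighbourhoodsAdjacent {d} G =
  ∀ {u v} → adj G u v ≡ true → ∀ {x y} → adj G x u ≡ true → x ≢ v → adj G y v ≡ true → y ≢ u → x ≢ y →
  adj G x y ≡ true

module _ {d} (G : Graph d) (dominate : EdgesDominate G) (adjacent : EdgeNeighbourhoodsAdjacent G) (u₀ : Fin d) where

  private
    adj-sym′ : ∀ {i j} → adj G i j ≡ true → adj G j i ≡ true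
    adj-sym′ {i} {j} ij = trans (adj-sym G j i) ij

    N : Fin d → Set
    N x = adj G u₀ x ≡ true

    N≢u₀ : ∀ {x} → N x → x ≢ u₀
    N≢u₀ u₀x refl = adj⇒≢ G u₀x refl

    ∉N-adj-N : ∀ {w v} → adj G u₀ w ≡ false → N v → adj G w v ≡ true
    ∉N-adj-N {w} {v} u₀w u₀v with dominate u₀v w
    ... | inj₁ wu₀ = contradiction (trans (sym (adj-sym′ wu₀)) u₀w) (λ ())
    ... | inj₂ wv  = wv

    ∉N-nonadj-∉N : ∀ {w₁ w₂} → adj G u₀ w₁ ≡ false → adj G u₀ w₂ ≡ false → adj G w₁ w₂ ≡ false
    ∉N-nonadj-∉N {w₁} {w₂} u₀w₁ u₀w₂ with adj G w₁ w₂ in w₁w₂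
    ... | false = refl
    ... | true with dominate w₁w₂ u₀
    ...   | inj₁ u₀w₁′ = contradiction (trans (sym u₀w₁′) u₀w₁) (λ ())
    ...   | inj₂ u₀w₂′ = contradiction (trans (sym u₀w₂′) u₀w₂) (λ ())

    adj-dec : ∀ i j → adj G i j ≡ true ⊎ adj G i j ≡ false
    adj-dec i j with adj G i j
    ... | true  = inj₁ refl
    ... | false = inj₂ refl

    edge-in-N⇒complete : ∀ {x y} → N x → N y → adj G x y ≡ true → IsComplete G
    edge-in-N⇒complete {x} {y} u₀x u₀y xy = complete
      where
      x-adj-N : ∀ {b} → N b → b ≢ x → adj G x b ≡ true
      x-adj-N {b} u₀b b≢x with b ≟ y
      ... | yes refl = xy
      ... | no  b≢y  = adj-sym′ (adjacent u₀y (adj-sym′ u₀b) b≢y xy (N≢u₀ u₀x) b≢x)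
      ∉N≢N : ∀ {a b} → adj G u₀ a ≡ false → N b → a ≢ b
      ∉N≢N u₀a u₀b refl = contradiction (trans (sym u₀a) u₀b) (λ ())
      complete : IsComplete G
      complete a b a≢b with adj-dec u₀ a | adj-dec u₀ b
      ... | inj₁ u₀a | inj₁ u₀b with a ≟ x | b ≟ x
      ...   | yes refl | _        = x-adj-N u₀b (a≢b ∘ sym)
      ...   | no  a≢x  | yes refl = adj-sym′ (x-adj-N u₀a a≢x)
      ...   | no  a≢x  | no  b≢x  = adjacent u₀x (adj-sym′ u₀a) a≢x (adj-sym′ (x-adj-N u₀b b≢x)) (N≢u₀ u₀b) a≢b
      complete a b a≢b | inj₁ u₀a | inj₂ u₀b = adj-sym′ (∉N-adj-N u₀b u₀a)
      complete a b a≢b | inj₂ u₀a | inj₁ u₀b = ∉N-adj-N u₀a u₀b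
      complete a b a≢b | inj₂ u₀a | inj₂ u₀b =
        adjacent xy (∉N-adj-N u₀a u₀x) (∉N≢N u₀a u₀y) (∉N-adj-N u₀b u₀y) (∉N≢N u₀b u₀x) a≢b

    no-edge-in-N⇒bipartite : (∀ x y → ¬ (N x × N y × adj G x y ≡ true)) →
                             ∀ i j → adj G i j ≡ adj G u₀ i xor adj G u₀ j
    no-edge-in-N⇒bipartite none i j with adj G u₀ i in u₀i | adj G u₀ j in u₀j
    ... | true  | true with adj G i j in ij
    ...   | false = refl
    ...   | true  = contradiction (u₀i , u₀j , ij) (none i j)
    no-edge-in-N⇒bipartite none i j | true  | false = adj-sym′ (∉N-adj-N u₀j u₀i)
    no-edge-in-N⇒bipartite none i j | false | true  = ∉N-adj-N u₀i u₀j
    no-edge-in-N⇒bipartite none i j | false | false = ∉N-nonadj-∉N u₀i u₀j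

  complete-or-bipartite : IsComplete G ⊎ (∀ i j → adj G i j ≡ adj G u₀ i xor adj G u₀ j)
  complete-or-bipartite
    with any? (λ x → any? (λ y → (adj G u₀ x Bool.≟ true) ×-dec (adj G u₀ y Bool.≟ true) ×-dec (adj G x y Bool.≟ true)))
  ... | yes (x , y , u₀x , u₀y , xy) = inj₁ (edge-in-N⇒complete u₀x u₀y xy)
  ... | no  none                     = inj₂ (no-edge-in-N⇒bipartite (λ x y e → none (x , y , e)))

module Bound {d} (G : Graph d) (ω : ℕ) (ω-bounds-cliques : ∀ k → HasClique G k → k ℕ.≤ ω) where
  open import Data.Rational using (_+_; _*_; _-_; -_; _<_)
  open import Tactic.RingSolver using (solve-∀)
  open ℚ∑ using (sum; sum-cong-≗; ∑-distrib-+; ∑∑; ∑∑-cong; ∑∑-distrib-+₃; *-distribˡ-∑∑)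
  open Counting G using (A; ∑edges; Slack; M; counting-identity; handshake; ∑edges-deg+deg; ∑edges-const)
  open MotzkinStraus G ω ω-bounds-cliques using (Aℚ; _·A·_; NonNeg; motzkin-straus)

  c₄ e n σ₂ : ℚ
  c₄ = ℕtoℚ (c4 G)
  e  = ℕtoℚ (edges G)
  n  = ℕtoℚ d
  σ₂ = ℕtoℚ (sigma2 G)

  excess : ℚ → Fin d → ℚ
  excess α i = ℕtoℚ (deg G i) - α

  X : ℚ → ℚ
  X α = ℕtoℚ 2 * e - α * n

  Q : ℚ → ℚ
  Q α = excess α ·A· excess α

  ℕtoℚ-∑edges : ∀ f → ℕtoℚ (∑edges f) ≡ ∑∑ (λ u v → Aℚ u v * ℕtoℚ (f u v))
  ℕtoℚ-∑edges f = trans (ℕtoℚ-∑ (λ u → ℕ∑.sum (λ v → A u v ℕ.* f u v))) (sum-cong-≗ (λ u →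
                  trans (ℕtoℚ-∑ (λ v → A u v ℕ.* f u v)) (sum-cong-≗ (λ v →
                  trans (ℕtoℚ-* (A u v) (f u v)) (cong (_* ℕtoℚ (f u v)) (ℕtoℚ-𝟙 (adj G u v)))))))

  sum-excess : ∀ α → sum (excess α) ≡ X α
  sum-excess α = begin
    sum (λ i → ℕtoℚ (deg G i) + - α)                  ≡⟨ ∑-distrib-+ (λ i → ℕtoℚ (deg G i)) (λ _ → - α) ⟩
    sum (λ i → ℕtoℚ (deg G i)) + sum {d} (λ _ → - α)  ≡⟨ cong₂ _+_ (sym (ℕtoℚ-∑ (deg G))) (∑-const d (- α)) ⟩
    ℕtoℚ (ℕ∑.sum (deg G)) + n * - α                    ≡⟨ cong (λ x → ℕtoℚ x + n * - α) handshake ⟩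
    ℕtoℚ (2 ℕ.* edges G) + n * - α                     ≡⟨ cong (_+ n * - α) (ℕtoℚ-* 2 (edges G)) ⟩
    ℕtoℚ 2 * e + n * - α                               ≡⟨ rearrange (ℕtoℚ 2 * e) n α ⟩
    X α                                                ∎
    where
    open ≡-Reasoning
    rearrange : ∀ t n α → t + n * - α ≡ t - α * n
    rearrange = solve-∀ ringℚ

  Q-expand : ∀ α → Q α ≡ ℕtoℚ M + - α * ℕtoℚ (2 ℕ.* sigma2 G) + α * α * ℕtoℚ (1 ℕ.* (2 ℕ.* edges G))
  Q-expand α = begin
    ∑∑ (λ u v → Aℚ u v * (excess α u * excess α v))
      ≡⟨ ∑∑-cong (λ u v → expand (Aℚ u v) (degℚ u) (degℚ v) α) ⟩
    ∑∑ (λ u v → Aℚ u v * (degℚ u * degℚ v) + - α * (Aℚ u v * (degℚ u + degℚ v)) + α * α * (Aℚ u v * 1ℚ))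
      ≡⟨ ∑∑-distrib-+₃ (λ u v → Aℚ u v * (degℚ u * degℚ v)) (λ u v → - α * (Aℚ u v * (degℚ u + degℚ v)))
                       (λ u v → α * α * (Aℚ u v * 1ℚ)) ⟩
    ∑∑ (λ u v → Aℚ u v * (degℚ u * degℚ v)) + ∑∑ (λ u v → - α * (Aℚ u v * (degℚ u + degℚ v)))
      + ∑∑ (λ u v → α * α * (Aℚ u v * 1ℚ))
      ≡⟨ cong₂ (λ x y → ∑∑ (λ u v → Aℚ u v * (degℚ u * degℚ v)) + x + y)
               (sym (*-distribˡ-∑∑ (- α) (λ u v → Aℚ u v * (degℚ u + degℚ v))))
               (sym (*-distribˡ-∑∑ (α * α) (λ u v → Aℚ u v * 1ℚ))) ⟩
    ∑∑ (λ u v → Aℚ u v * (degℚ u * degℚ v)) + - α * ∑∑ (λ u v → Aℚ u v * (degℚ u + degℚ v))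
      + α * α * ∑∑ (λ u v → Aℚ u v * 1ℚ)
      ≡⟨ cong₃ (λ x y z → x + - α * y + α * α * z)
               (sym (trans (ℕtoℚ-∑edges (λ u v → deg G u ℕ.* deg G v))
                           (∑∑-cong (λ u v → cong (Aℚ u v *_) (ℕtoℚ-* (deg G u) (deg G v))))))
               (sym (trans (ℕtoℚ-∑edges (λ u v → deg G u ℕ.+ deg G v))
                           (∑∑-cong (λ u v → cong (Aℚ u v *_) (ℕtoℚ-+ (deg G u) (deg G v))))))
               (sym (trans (ℕtoℚ-∑edges (λ _ _ → 1)) (∑∑-cong (λ u v → cong (Aℚ u v *_) ℕtoℚ-1)))) ⟩
    ℕtoℚ M + - α * ℕtoℚ (∑edges (λ u v → deg G u ℕ.+ deg G v)) + α * α * ℕtoℚ (∑edges (λ _ _ → 1))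
      ≡⟨ cong₂ (λ x y → ℕtoℚ M + - α * ℕtoℚ x + α * α * ℕtoℚ y) ∑edges-deg+deg (∑edges-const 1) ⟩
    ℕtoℚ M + - α * ℕtoℚ (2 ℕ.* sigma2 G) + α * α * ℕtoℚ (1 ℕ.* (2 ℕ.* edges G))
      ∎
    where
    open ≡-Reasoning
    degℚ : Fin d → ℚ
    degℚ i = ℕtoℚ (deg G i)
    expand : ∀ a x y α → a * ((x - α) * (y - α)) ≡ a * (x * y) + - α * (a * (x + y)) + α * α * (a * 1ℚ)
    expand = solve-∀ ringℚ

  counting-identityℚ : ℕtoℚ M ≡ ℕtoℚ 8 * c₄ + ℕtoℚ 4 * σ₂ + ℕtoℚ Slack - (n + 1ℚ) * (ℕtoℚ 2 * e)
  counting-identityℚ = trans (sym (a+b-b≡a (ℕtoℚ M) ((n + 1ℚ) * (ℕtoℚ 2 * e))))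
    (cong (_- (n + 1ℚ) * (ℕtoℚ 2 * e)) (trans (sym rhs) (trans (cong ℕtoℚ (sym counting-identity)) lhs)))
    where
    a+b-b≡a : ∀ a b → a + b - b ≡ a
    a+b-b≡a = solve-∀ ringℚ
    lhs : ℕtoℚ (8 ℕ.* c4 G ℕ.+ 4 ℕ.* sigma2 G ℕ.+ Slack) ≡ ℕtoℚ 8 * c₄ + ℕtoℚ 4 * σ₂ + ℕtoℚ Slack
    lhs = trans (ℕtoℚ-+ (8 ℕ.* c4 G ℕ.+ 4 ℕ.* sigma2 G) Slack) (cong (_+ ℕtoℚ Slack)
                (trans (ℕtoℚ-+ (8 ℕ.* c4 G) (4 ℕ.* sigma2 G)) (cong₂ _+_ (ℕtoℚ-* 8 (c4 G)) (ℕtoℚ-* 4 (sigma2 G)))))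
    rhs : ℕtoℚ (M ℕ.+ (d ℕ.+ 1) ℕ.* (2 ℕ.* edges G)) ≡ ℕtoℚ M + (n + 1ℚ) * (ℕtoℚ 2 * e)
    rhs = trans (ℕtoℚ-+ M ((d ℕ.+ 1) ℕ.* (2 ℕ.* edges G))) (cong (ℕtoℚ M +_)
                (trans (ℕtoℚ-* (d ℕ.+ 1) (2 ℕ.* edges G))
                       (cong₂ _*_ (trans (ℕtoℚ-+ d 1) (cong (n +_) ℕtoℚ-1)) (ℕtoℚ-* 2 (edges G)))))

  gap : ℚ → ℚ → ℚ
  gap α β = (1ℚ - recip β) * (X α * X α) - Q α

  c4Bound-decomposition : ∀ α β → c4Bound G α β ≡ c₄ + recip (ℕtoℚ 8) * (gap α β + ℕtoℚ Slack)
  c4Bound-decomposition α β = begin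
    c4Bound G α β
      ≡⟨ identity c₄ σ₂ e n α (recip β) (ℕtoℚ Slack) ⟩
    c₄ + recip (ℕtoℚ 8) * ((1ℚ - recip β) * (X α * X α) - Q′ + ℕtoℚ Slack)
      ≡⟨ cong (λ q → c₄ + recip (ℕtoℚ 8) * ((1ℚ - recip β) * (X α * X α) - q + ℕtoℚ Slack)) (sym Q≡Q′) ⟩
    c₄ + recip (ℕtoℚ 8) * (gap α β + ℕtoℚ Slack)
      ∎
    where
    open ≡-Reasoning
    Q′ = (ℕtoℚ 8 * c₄ + ℕtoℚ 4 * σ₂ + ℕtoℚ Slack - (n + 1ℚ) * (ℕtoℚ 2 * e)) + - α * (ℕtoℚ 2 * σ₂) + α * α * (ℕtoℚ 2 * e)
    Q≡Q′ : Q α ≡ Q′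
    Q≡Q′ = trans (Q-expand α) (cong₃ (λ x y z → x + - α * y + α * α * z) counting-identityℚ (ℕtoℚ-* 2 (sigma2 G))
                                     (trans (cong ℕtoℚ (ℕ.*-identityˡ (2 ℕ.* edges G))) (ℕtoℚ-* 2 (edges G))))
    identity : ∀ c s e n α r S →
      ((ℕtoℚ 2 * e - α * n) * (ℕtoℚ 2 * e - α * n)) * recip (ℕtoℚ 8) * (1ℚ - r)
        + e * (n - α * α + 1ℚ) * recip (ℕtoℚ 4) + (α - ℕtoℚ 2) * recip (ℕtoℚ 4) * s
      ≡ c + recip (ℕtoℚ 8) * ((1ℚ - r) * ((ℕtoℚ 2 * e - α * n) * (ℕtoℚ 2 * e - α * n))
            - ((ℕtoℚ 8 * c + ℕtoℚ 4 * s + S - (n + 1ℚ) * (ℕtoℚ 2 * e)) + - α * (ℕtoℚ 2 * s) + α * α * (ℕtoℚ 2 * e)) + S)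
    identity = solve-∀ ringℚ

  0≤excess : ∀ {α} → α ≤ ℕtoℚ (minDeg G) → NonNeg (excess α)
  0≤excess α≤δ i = p≤q⇒0≤q-p (ℚ.≤-trans α≤δ (ℕtoℚ-mono-≤ (minDeg≤deg G i)))

  0≤gap-at-ω : ∀ α → 0ℚ < ℕtoℚ ω → α ≤ ℕtoℚ (minDeg G) → 0ℚ ≤ gap α (ℕtoℚ ω)
  0≤gap-at-ω α ω>0 α≤δ = subst (0ℚ ≤_) scaled (*-nonNeg (recip-nonNeg (ℕtoℚ ω) ω>0) (p≤q⇒0≤q-p ωQ≤[ω-1]X²))
    where
    open ≡-Reasoning
    ωQ≤[ω-1]X² : ℕtoℚ ω * Q α ≤ (ℕtoℚ ω - 1ℚ) * (X α * X α)
    ωQ≤[ω-1]X² = subst (λ s → ℕtoℚ ω * Q α ≤ (ℕtoℚ ω - 1ℚ) * (s * s)) (sum-excess α)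
                       (motzkin-straus (excess α) (0≤excess α≤δ))
    expand : ∀ r w x q → r * ((w - 1ℚ) * x - w * q) ≡ (r * w) * x - r * x - (r * w) * q
    expand = solve-∀ ringℚ
    simplify : ∀ r x q → 1ℚ * x - r * x - 1ℚ * q ≡ (1ℚ - r) * x - q
    simplify = solve-∀ ringℚ
    scaled : recip (ℕtoℚ ω) * ((ℕtoℚ ω - 1ℚ) * (X α * X α) - ℕtoℚ ω * Q α) ≡ gap α (ℕtoℚ ω)
    scaled = begin
      recip (ℕtoℚ ω) * ((ℕtoℚ ω - 1ℚ) * (X α * X α) - ℕtoℚ ω * Q α)
        ≡⟨ expand (recip (ℕtoℚ ω)) (ℕtoℚ ω) (X α * X α) (Q α) ⟩
      (recip (ℕtoℚ ω) * ℕtoℚ ω) * (X α * X α) - recip (ℕtoℚ ω) * (X α * X α) - (recip (ℕtoℚ ω) * ℕtoℚ ω) * Q α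
        ≡⟨ cong (λ one → one * (X α * X α) - recip (ℕtoℚ ω) * (X α * X α) - one * Q α) (recip-*-inverseˡ (ℕtoℚ ω) ω>0) ⟩
      1ℚ * (X α * X α) - recip (ℕtoℚ ω) * (X α * X α) - 1ℚ * Q α
        ≡⟨ simplify (recip (ℕtoℚ ω)) (X α * X α) (Q α) ⟩
      gap α (ℕtoℚ ω)
        ∎

  0≤gap : ∀ α β → 0ℚ < ℕtoℚ ω → α ≤ ℕtoℚ (minDeg G) → ℕtoℚ ω ≤ β → 0ℚ ≤ gap α β
  0≤gap α β ω>0 α≤δ ω≤β =
    subst (0ℚ ≤_) (sym (split (recip β) (recip (ℕtoℚ ω)) (X α * X α) (Q α)))
          (+-nonNeg (*-nonNeg (recip-antimono (ℕtoℚ ω) β ω>0 ω≤β) (square-nonNeg (X α))) (0≤gap-at-ω α ω>0 α≤δ))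
    where
    split : ∀ r r₀ x q → (1ℚ - r) * x - q ≡ (r₀ - r) * x + ((1ℚ - r₀) * x - q)
    split = solve-∀ ringℚ

  c4≤c4Bound : ∀ α β → 0ℚ < ℕtoℚ ω → α ≤ ℕtoℚ (minDeg G) → ℕtoℚ ω ≤ β → c₄ ≤ c4Bound G α β
  c4≤c4Bound α β ω>0 α≤δ ω≤β =
    subst₂ _≤_ (ℚ.+-identityʳ c₄) (sym (c4Bound-decomposition α β))
           (ℚ.+-monoʳ-≤ c₄ (*-nonNeg (recip-nonNeg (ℕtoℚ 8) (0<ℕtoℚ 7)) (+-nonNeg (0≤gap α β ω>0 α≤δ ω≤β) (0≤ℕtoℚ Slack))))

  c4≡c4Bound⇒gap+Slack≡0 : ∀ α β → c₄ ≡ c4Bound G α β → gap α β + ℕtoℚ Slack ≡ 0ℚ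
  c4≡c4Bound⇒gap+Slack≡0 α β c₄≡bound = begin
    z                                  ≡⟨ times-8 z ⟩
    ℕtoℚ 8 * (recip (ℕtoℚ 8) * z)      ≡⟨ cong (ℕtoℚ 8 *_) (trans (cancel c₄ (recip (ℕtoℚ 8) * z))
                                                    (cong (_- c₄) (sym (trans c₄≡bound (c4Bound-decomposition α β))))) ⟩
    ℕtoℚ 8 * (c₄ - c₄)                 ≡⟨ cong (ℕtoℚ 8 *_) (ℚ.+-inverseʳ c₄) ⟩
    ℕtoℚ 8 * 0ℚ                        ≡⟨ ℚ.*-zeroʳ (ℕtoℚ 8) ⟩
    0ℚ                                 ∎
    where
    open ≡-Reasoning
    z = gap α β + ℕtoℚ Slack
    times-8 : ∀ z → z ≡ ℕtoℚ 8 * (recip (ℕtoℚ 8) * z)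
    times-8 = solve-∀ ringℚ
    cancel : ∀ c x → x ≡ c + x - c
    cancel = solve-∀ ringℚ

  gap+Slack≡0⇒c4≡c4Bound : ∀ α β → gap α β + ℕtoℚ Slack ≡ 0ℚ → c₄ ≡ c4Bound G α β
  gap+Slack≡0⇒c4≡c4Bound α β z≡0 = sym (begin
    c4Bound G α β                                   ≡⟨ c4Bound-decomposition α β ⟩
    c₄ + recip (ℕtoℚ 8) * (gap α β + ℕtoℚ Slack)    ≡⟨ cong (λ z → c₄ + recip (ℕtoℚ 8) * z) z≡0 ⟩
    c₄ + recip (ℕtoℚ 8) * 0ℚ                        ≡⟨ cong (c₄ +_) (ℚ.*-zeroʳ (recip (ℕtoℚ 8))) ⟩
    c₄ + 0ℚ                                         ≡⟨ ℚ.+-identityʳ c₄ ⟩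
    c₄                                              ∎)
    where open ≡-Reasoning

module SlackZero {d} (G : Graph d) where
  open import Data.Nat using (_+_; _*_)
  open Counting G
  open ℕ∑ using (sum)

  Slack≡0⇒slack≡0 : Slack ≡ 0 → ∀ {u v} → adj G u v ≡ true → slack u v ≡ 0
  Slack≡0⇒slack≡0 Slack≡0 {u} {v} uv =
    trans (sym (ℕ.+-identityʳ (slack u v)))
          (subst (λ b → 𝟙 b * slack u v ≡ 0) uv
                 (∑≡0⇒≡0 (λ v′ → A u v′ * slack u v′) (∑≡0⇒≡0 (λ u′ → sum (λ v′ → A u′ v′ * slack u′ v′)) Slack≡0 u) v))

  slack≡0⇒Slack≡0 : (∀ {u v} → adj G u v ≡ true → slack u v ≡ 0) → Slack ≡ 0
  slack≡0⇒Slack≡0 slack≡0 = ℕ∑.∑-zero (λ u → ℕ∑.∑-zero (λ v → edge-term u v))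
    where
    edge-term : ∀ u v → A u v * slack u v ≡ 0
    edge-term u v with adj G u v in uv
    ... | true  = trans (ℕ.+-identityʳ (slack u v)) (slack≡0 uv)
    ... | false = refl

  nonNbrs≡0⇒dominated : ∀ {u v} → nonNbrs u v ≡ 0 → ∀ w → adj G w u ≡ true ⊎ adj G w v ≡ true
  nonNbrs≡0⇒dominated {u} {v} nonNbrs≡0 w with adj G w u in wu | adj G w v in wv
  ... | true  | _     = inj₁ refl
  ... | false | true  = inj₂ refl
  ... | false | false = contradiction (trans (sym term≡1) (∑≡0⇒≡0 (λ x → Aᶜ x u * Aᶜ x v) nonNbrs≡0 w)) (λ ())
    where
    term≡1 : Aᶜ w u * Aᶜ w v ≡ 1
    term≡1 = cong₂ (λ a b → 𝟙 (not a) * 𝟙 (not b)) wu wv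

  dominated⇒nonNbrs≡0 : ∀ {u v} → (∀ w → adj G w u ≡ true ⊎ adj G w v ≡ true) → nonNbrs u v ≡ 0
  dominated⇒nonNbrs≡0 {u} {v} dominated = ℕ∑.∑-zero term≡0
    where
    term≡0 : ∀ w → Aᶜ w u * Aᶜ w v ≡ 0
    term≡0 w with dominated w
    ... | inj₁ wu = cong (λ b → 𝟙 (not b) * Aᶜ w v) wu
    ... | inj₂ wv = trans (cong (λ b → Aᶜ w u * 𝟙 (not b)) wv) (ℕ.*-zeroʳ (Aᶜ w u))

  NeighbourhoodsAdjacentAt : Fin d → Fin d → Set
  NeighbourhoodsAdjacentAt u v =
    ∀ {x y} → adj G x u ≡ true → x ≢ v → adj G y v ≡ true → y ≢ u → x ≢ y → adj G x y ≡ true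

  nonAdjPairs≡0⇒adjacent : ∀ {u v} → nonAdjPairs u v ≡ 0 → NeighbourhoodsAdjacentAt u v
  nonAdjPairs≡0⇒adjacent {u} {v} nonAdjPairs≡0 {x} {y} xu x≢v yv y≢u x≢y with adj G x y in xy
  ... | true  = refl
  ... | false = contradiction (trans (sym term≡1) term≡0) (λ ())
    where
    term≡0 : N⁻ u v x * N⁻ v u y * (δᶜ x y * Aᶜ x y) ≡ 0
    term≡0 = ∑≡0⇒≡0 _ (∑≡0⇒≡0 (λ x′ → sum (λ y′ → N⁻ u v x′ * N⁻ v u y′ * (δᶜ x′ y′ * Aᶜ x′ y′))) nonAdjPairs≡0 x) y
    term≡1 : 𝟙 (adj G x u) * 𝟙 (distinct x v) * (𝟙 (adj G y v) * 𝟙 (distinct y u))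
             * (𝟙 (distinct x y) * 𝟙 (not (adj G x y))) ≡ 1
    term≡1 rewrite xu | ≢⇒distinct x≢v | yv | ≢⇒distinct y≢u | ≢⇒distinct x≢y | xy = refl

  adjacent⇒nonAdjPairs≡0 : ∀ {u v} → NeighbourhoodsAdjacentAt u v → nonAdjPairs u v ≡ 0
  adjacent⇒nonAdjPairs≡0 {u} {v} adjacent = ℕ∑.∑-zero (λ x → ℕ∑.∑-zero (term≡0 x))
    where
    term≡0 : ∀ x y → 𝟙 (adj G x u) * 𝟙 (distinct x v) * (𝟙 (adj G y v) * 𝟙 (distinct y u))
                     * (𝟙 (distinct x y) * 𝟙 (not (adj G x y))) ≡ 0
    term≡0 x y with adj G x u in xu | distinct x v in xv | adj G y v in yv | distinct y u in yu
                  | distinct x y in x≠y | adj G x y in xy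
    ... | true  | true  | true  | true  | true  | true  = refl
    ... | true  | true  | true  | true  | true  | false =
      contradiction (trans (sym (adjacent xu (distinct⇒≢ xv) yv (distinct⇒≢ yu) (distinct⇒≢ x≠y))) xy) (λ ())
    ... | true  | true  | true  | true  | false | _     = refl
    ... | true  | true  | true  | false | _     | _     = refl
    ... | true  | true  | false | _     | _     | _     = refl
    ... | true  | false | _     | _     | _     | _     = refl
    ... | false | _     | _     | _     | _     | _     = refl

  Slack≡0⇒dominate×adjacent : Slack ≡ 0 → EdgesDominate G × EdgeNeighbourhoodsAdjacent G
  Slack≡0⇒dominate×adjacent Slack≡0 =
    (λ uv → nonNbrs≡0⇒dominated (ℕ.m+n≡0⇒n≡0 (nonAdjPairs _ _) (Slack≡0⇒slack≡0 Slack≡0 uv))) ,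
    (λ uv → nonAdjPairs≡0⇒adjacent (ℕ.m+n≡0⇒m≡0 (nonAdjPairs _ _) (Slack≡0⇒slack≡0 Slack≡0 uv)))

  dominate×adjacent⇒Slack≡0 : EdgesDominate G → EdgeNeighbourhoodsAdjacent G → Slack ≡ 0
  dominate×adjacent⇒Slack≡0 dominate adjacent = slack≡0⇒Slack≡0 (λ uv →
    cong₂ _+_ (adjacent⇒nonAdjPairs≡0 (adjacent uv)) (dominated⇒nonNbrs≡0 (dominate uv)))

xor-either : ∀ a b c → a xor b ≡ true → c xor a ≡ true ⊎ c xor b ≡ true
xor-either true  false true  _ = inj₂ refl
xor-either true  false false _ = inj₁ refl
xor-either false true  true  _ = inj₁ refl
xor-either false true  false _ = inj₂ refl

xor-path₃ : ∀ a b c e → a xor c ≡ true → c xor e ≡ true → e xor b ≡ true → a xor b ≡ true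
xor-path₃ true  false false true  _ _ _ = refl
xor-path₃ false true  true  false _ _ _ = refl

module CompleteGraph {n} (G : Graph (suc n)) (complete : IsComplete G) where
  open import Data.Nat using (_+_; _*_)
  open ℕ∑ using (sum; sum-cong-≗; ∑-distrib-+; δ; ∑-*δ)
  open Counting G using (A; A-irrefl; deg≡∑A)

  complete⇒dominate : EdgesDominate G
  complete⇒dominate {u} {v} uv w with w ≟ u
  ... | yes refl = inj₂ uv
  ... | no  w≢u  = inj₁ (complete w u w≢u)

  complete⇒adjacent : EdgeNeighbourhoodsAdjacent G
  complete⇒adjacent _ _ _ _ _ x≢y = complete _ _ x≢y

  deg-complete : ∀ i → deg G i ≡ n
  deg-complete i = ℕ.suc-injective (begin
    suc (deg G i)                            ≡⟨ ℕ.+-comm 1 (deg G i) ⟩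
    deg G i + 1                              ≡⟨ cong₂ _+_ (deg≡∑A i) (sym (∑-*δ (λ _ → 1) i)) ⟩
    sum (A i) + sum (λ j → 1 * δ j i)        ≡⟨ sym (∑-distrib-+ (A i) (λ j → 1 * δ j i)) ⟩
    sum (λ j → A i j + 1 * δ j i)            ≡⟨ sum-cong-≗ A+δ≡1 ⟩
    sum {suc n} (λ _ → 1)                    ≡⟨ ∑-const-1 (suc n) ⟩
    suc n                                    ∎)
    where
    open ≡-Reasoning
    A+δ≡1 : ∀ j → A i j + 1 * δ j i ≡ 1
    A+δ≡1 j with j ≟ i
    ... | yes refl = cong (_+ 1) (A-irrefl i)
    ... | no  j≢i  = cong (λ b → 𝟙 b + 0) (complete i j (j≢i ∘ sym))

module BipartiteGraph {d} (G : Graph d) (side : Fin d → Bool) (bipartite : ∀ i j → adj G i j ≡ side i xor side j) where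
  open import Data.Nat using (_+_)
  open ℕ∑ using (sum; sum-cong-≗; ∑-distrib-+)

  #true #false : ℕ
  #true  = sum (λ j → 𝟙 (side j))
  #false = sum (λ j → 𝟙 (not (side j)))

  #false+#true≡d : #false + #true ≡ d
  #false+#true≡d = trans (sym (∑-distrib-+ (λ j → 𝟙 (not (side j))) (λ j → 𝟙 (side j))))
                         (trans (sum-cong-≗ one-side) (∑-const-1 d))
    where
    one-side : ∀ j → 𝟙 (not (side j)) + 𝟙 (side j) ≡ 1
    one-side j with side j
    ... | true  = refl
    ... | false = refl

  deg≡∑xor : ∀ i → deg G i ≡ sum (λ j → 𝟙 (side i xor side j))
  deg≡∑xor i = trans (count-allFin (adj G i)) (sum-cong-≗ (λ j → cong 𝟙 (bipartite i j)))

  deg-true : ∀ {i} → side i ≡ true → deg G i ≡ #false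
  deg-true {i} i-true = trans (deg≡∑xor i) (sum-cong-≗ (λ j → cong (λ b → 𝟙 (b xor side j)) i-true))

  deg-false : ∀ {i} → side i ≡ false → deg G i ≡ #true
  deg-false {i} i-false = trans (deg≡∑xor i) (sum-cong-≗ (λ j → cong (λ b → 𝟙 (b xor side j)) i-false))

  same-side⇒same-deg : ∀ {i j} → side i ≡ side j → deg G i ≡ deg G j
  same-side⇒same-deg {i} {j} same = trans (deg≡∑xor i) (trans (sum-cong-≗ (λ k → cong (λ b → 𝟙 (b xor side k)) same))
                                                              (sym (deg≡∑xor j)))

  bipartite⇒dominate : EdgesDominate G
  bipartite⇒dominate {u} {v} uv w with xor-either (side u) (side v) (side w) (trans (sym (bipartite u v)) uv)
  ... | inj₁ wu = inj₁ (trans (bipartite w u) wu)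
  ... | inj₂ wv = inj₂ (trans (bipartite w v) wv)

  bipartite⇒adjacent : EdgeNeighbourhoodsAdjacent G
  bipartite⇒adjacent {u} {v} uv {x} {y} xu _ yv _ _ = trans (bipartite x y)
    (xor-path₃ (side x) (side y) (side u) (side v)
      (trans (sym (bipartite x u)) xu) (trans (sym (bipartite u v)) uv)
      (trans (sym (bipartite v y)) (trans (adj-sym G v y) yv)))

module _ {n} (G : Graph (suc n)) (δ≥2 : 2 ≤ℕ minDeg G) (ω : ℕ) (ω-clique-number : IsCliqueNumber G ω) where
  open import Data.Rational using (_+_; _*_; _-_; _<_)
  open import Tactic.RingSolver using (solve-∀)
  open Bound G ω (proj₂ ω-clique-number)
    using (excess; X; Q; gap; sum-excess; 0≤gap; c4≤c4Bound; c4≡c4Bound⇒gap+Slack≡0; gap+Slack≡0⇒c4≡c4Bound)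
  open SlackZero G using (Slack≡0⇒dominate×adjacent; dominate×adjacent⇒Slack≡0)
  open Counting G using (Slack)
  open ℚ∑ using (∑-zero; sum-cong-≗)

  δ : ℕ
  δ = minDeg G

  ω≥2 : 2 ≤ℕ ω
  ω≥2 with deg>0⇒edge G zero (ℕ.≤-trans (s≤s z≤n) (ℕ.≤-trans δ≥2 (minDeg≤deg G zero)))
  ... | _ , 0v = proj₂ ω-clique-number 2 (edge⇒clique₂ G 0v)

  ω>0 : 0ℚ < ℕtoℚ ω
  ω>0 = ℚ.<-≤-trans (0<ℕtoℚ 0) (ℕtoℚ-mono-≤ (ℕ.≤-trans (s≤s z≤n) ω≥2))

  Regular : Set
  Regular = ∀ i → deg G i ≡ δ

  excess-δ≡ℕ : ∀ i → excess (ℕtoℚ δ) i ≡ ℕtoℚ (deg G i ℕ.∸ δ)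
  excess-δ≡ℕ i = sym (ℕtoℚ-∸ (minDeg≤deg G i))

  excess-δ≡0 : ∀ {i} → deg G i ≡ δ → excess (ℕtoℚ δ) i ≡ 0ℚ
  excess-δ≡0 {i} i-min = trans (cong (λ k → ℕtoℚ k - ℕtoℚ δ) i-min) (ℚ.+-inverseʳ (ℕtoℚ δ))

  X-δ≡ℕ : X (ℕtoℚ δ) ≡ ℕtoℚ (ℕ∑.sum (λ i → deg G i ℕ.∸ δ))
  X-δ≡ℕ = trans (sym (sum-excess (ℕtoℚ δ))) (trans (sum-cong-≗ excess-δ≡ℕ) (sym (ℕtoℚ-∑ (λ i → deg G i ℕ.∸ δ))))

  regular⇒gap≡0 : Regular → gap (ℕtoℚ δ) (ℕtoℚ ω) ≡ 0ℚ
  regular⇒gap≡0 regular =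
    trans (cong₂ (λ x q → (1ℚ - recip (ℕtoℚ ω)) * (x * x) - q) X≡0 Q≡0) (vanish (recip (ℕtoℚ ω)))
    where
    a*[0*b]≡0 : ∀ a b → a * (0ℚ * b) ≡ 0ℚ
    a*[0*b]≡0 = solve-∀ ringℚ
    vanish : ∀ r → (1ℚ - r) * (0ℚ * 0ℚ) - 0ℚ ≡ 0ℚ
    vanish = solve-∀ ringℚ
    X≡0 : X (ℕtoℚ δ) ≡ 0ℚ
    X≡0 = trans (sym (sum-excess (ℕtoℚ δ))) (∑-zero (λ i → excess-δ≡0 (regular i)))
    Q≡0 : Q (ℕtoℚ δ) ≡ 0ℚ
    Q≡0 = ∑-zero (λ k → ∑-zero (λ l →
            trans (cong (λ x → 𝟙ℚ (adj G k l) * (x * excess (ℕtoℚ δ) l)) (excess-δ≡0 (regular k)))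
                  (a*[0*b]≡0 (𝟙ℚ (adj G k l)) (excess (ℕtoℚ δ) l))))

  ∑excess≡0⇒regular : ℕ∑.sum (λ i → deg G i ℕ.∸ δ) ≡ 0 → Regular
  ∑excess≡0⇒regular ∑≡0 i =
    ℕ.≤-antisym (ℕ.m∸n≡0⇒m≤n (∑≡0⇒≡0 (λ j → deg G j ℕ.∸ δ) ∑≡0 i)) (minDeg≤deg G i)

  [1-1/ω]N²≡0⇒N≡0 : ∀ N → (1ℚ - recip (ℕtoℚ ω)) * (ℕtoℚ N * ℕtoℚ N) ≡ 0ℚ → N ≡ 0
  [1-1/ω]N²≡0⇒N≡0 N vanishes = [ ω≢1 , N*N≡0⇒N≡0 ]′ (ℕ.m*n≡0⇒m≡0∨n≡0 (ω ℕ.∸ 1) product≡0)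
    where
    open ≡-Reasoning
    x = ℕtoℚ N * ℕtoℚ N
    expand : ∀ w r x → w * ((1ℚ - r) * x) ≡ w * x - (r * w) * x
    expand = solve-∀ ringℚ
    collect : ∀ w x → w * x - 1ℚ * x ≡ (w - 1ℚ) * x
    collect = solve-∀ ringℚ
    cast : ℕtoℚ ((ω ℕ.∸ 1) ℕ.* (N ℕ.* N)) ≡ 0ℚ
    cast = begin
      ℕtoℚ ((ω ℕ.∸ 1) ℕ.* (N ℕ.* N))              ≡⟨ ℕtoℚ-* (ω ℕ.∸ 1) (N ℕ.* N) ⟩
      ℕtoℚ (ω ℕ.∸ 1) * ℕtoℚ (N ℕ.* N)              ≡⟨ cong₂ _*_ (ℕtoℚ-∸ (ℕ.≤-trans (s≤s z≤n) ω≥2)) (ℕtoℚ-* N N) ⟩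
      (ℕtoℚ ω - ℕtoℚ 1) * x                        ≡⟨ cong (λ one → (ℕtoℚ ω - one) * x) ℕtoℚ-1 ⟩
      (ℕtoℚ ω - 1ℚ) * x                            ≡⟨ sym (collect (ℕtoℚ ω) x) ⟩
      ℕtoℚ ω * x - 1ℚ * x                          ≡⟨ cong (λ one → ℕtoℚ ω * x - one * x) (sym (recip-*-inverseˡ (ℕtoℚ ω) ω>0)) ⟩
      ℕtoℚ ω * x - (recip (ℕtoℚ ω) * ℕtoℚ ω) * x   ≡⟨ sym (expand (ℕtoℚ ω) (recip (ℕtoℚ ω)) x) ⟩
      ℕtoℚ ω * ((1ℚ - recip (ℕtoℚ ω)) * x)         ≡⟨ cong (ℕtoℚ ω *_) vanishes ⟩
      ℕtoℚ ω * 0ℚ                                  ≡⟨ ℚ.*-zeroʳ (ℕtoℚ ω) ⟩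
      0ℚ                                           ∎
    product≡0 : (ω ℕ.∸ 1) ℕ.* (N ℕ.* N) ≡ 0
    product≡0 = ℕtoℚ-injective {(ω ℕ.∸ 1) ℕ.* (N ℕ.* N)} {0} (trans cast (sym ℕtoℚ-0))
    ω≢1 : ω ℕ.∸ 1 ≡ 0 → N ≡ 0
    ω≢1 ω∸1≡0 = contradiction ω∸1≡0 (ℕ.m>n⇒m∸n≢0 ω≥2)
    N*N≡0⇒N≡0 : N ℕ.* N ≡ 0 → N ≡ 0
    N*N≡0⇒N≡0 N*N≡0 = [ id , id ]′ (ℕ.m*n≡0⇒m≡0∨n≡0 N N*N≡0)

  gap≡0⇒Q≡0⇒regular : gap (ℕtoℚ δ) (ℕtoℚ ω) ≡ 0ℚ → Q (ℕtoℚ δ) ≡ 0ℚ → Regular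
  gap≡0⇒Q≡0⇒regular gap≡0 Q≡0 = ∑excess≡0⇒regular ([1-1/ω]N²≡0⇒N≡0 N [1-1/ω]N²≡0)
    where
    open ≡-Reasoning
    N = ℕ∑.sum (λ i → deg G i ℕ.∸ δ)
    x-0≡x : ∀ x → x - 0ℚ ≡ x
    x-0≡x = solve-∀ ringℚ
    [1-1/ω]N²≡0 : (1ℚ - recip (ℕtoℚ ω)) * (ℕtoℚ N * ℕtoℚ N) ≡ 0ℚ
    [1-1/ω]N²≡0 = begin
      (1ℚ - recip (ℕtoℚ ω)) * (ℕtoℚ N * ℕtoℚ N)         ≡⟨ sym (x-0≡x ((1ℚ - recip (ℕtoℚ ω)) * (ℕtoℚ N * ℕtoℚ N))) ⟩
      (1ℚ - recip (ℕtoℚ ω)) * (ℕtoℚ N * ℕtoℚ N) - 0ℚ    ≡⟨ cong₂ (λ x q → (1ℚ - recip (ℕtoℚ ω)) * (x * x) - q) (sym X-δ≡ℕ) (sym Q≡0) ⟩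
      gap (ℕtoℚ δ) (ℕtoℚ ω)                              ≡⟨ gap≡0 ⟩
      0ℚ                                                 ∎

  module _ (side : Fin (suc n) → Bool) (bipartite : ∀ i j → adj G i j ≡ side i xor side j) where
    open BipartiteGraph G side bipartite using (same-side⇒same-deg)

    bipartite-edge-has-min-degree-end : ∀ {k l} → adj G k l ≡ true → deg G k ≡ δ ⊎ deg G l ≡ δ
    bipartite-edge-has-min-degree-end {k} {l} kl with minDeg-attained G
    ... | w , δ≡dw = endpoint (side k) (side l) (side w) refl refl refl (trans (sym (bipartite k l)) kl)
      where
      endpoint : ∀ a b c → side k ≡ a → side l ≡ b → side w ≡ c → a xor b ≡ true → deg G k ≡ δ ⊎ deg G l ≡ δ
      endpoint true  false true  k≡ _  w≡ _ = inj₁ (trans (same-side⇒same-deg (trans k≡ (sym w≡))) (sym δ≡dw))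
      endpoint true  false false _  l≡ w≡ _ = inj₂ (trans (same-side⇒same-deg (trans l≡ (sym w≡))) (sym δ≡dw))
      endpoint false true  true  _  l≡ w≡ _ = inj₂ (trans (same-side⇒same-deg (trans l≡ (sym w≡))) (sym δ≡dw))
      endpoint false true  false k≡ _  w≡ _ = inj₁ (trans (same-side⇒same-deg (trans k≡ (sym w≡))) (sym δ≡dw))

    bipartite⇒Q≡0 : Q (ℕtoℚ δ) ≡ 0ℚ
    bipartite⇒Q≡0 = ∑-zero (λ k → ∑-zero (λ l → term≡0 k l (nonadjacent-or-min-degree-end k l)))
      where
      a*[0*b]≡0 : ∀ a b → a * (0ℚ * b) ≡ 0ℚ
      a*[0*b]≡0 = solve-∀ ringℚ
      a*[b*0]≡0 : ∀ a b → a * (b * 0ℚ) ≡ 0ℚ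
      a*[b*0]≡0 = solve-∀ ringℚ
      nonadjacent-or-min-degree-end : ∀ k l → adj G k l ≡ false ⊎ deg G k ≡ δ ⊎ deg G l ≡ δ
      nonadjacent-or-min-degree-end k l with adj G k l in kl
      ... | false = inj₁ refl
      ... | true  = inj₂ (bipartite-edge-has-min-degree-end kl)
      term≡0 : ∀ k l → adj G k l ≡ false ⊎ deg G k ≡ δ ⊎ deg G l ≡ δ →
               𝟙ℚ (adj G k l) * (excess (ℕtoℚ δ) k * excess (ℕtoℚ δ) l) ≡ 0ℚ
      term≡0 k l (inj₁ kl) = trans (cong (λ b → 𝟙ℚ b * (excess (ℕtoℚ δ) k * excess (ℕtoℚ δ) l)) kl)
                                   (ℚ.*-zeroˡ (excess (ℕtoℚ δ) k * excess (ℕtoℚ δ) l))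
      term≡0 k l (inj₂ (inj₁ k-min)) =
        trans (cong (λ x → 𝟙ℚ (adj G k l) * (x * excess (ℕtoℚ δ) l)) (excess-δ≡0 k-min))
              (a*[0*b]≡0 (𝟙ℚ (adj G k l)) (excess (ℕtoℚ δ) l))
      term≡0 k l (inj₂ (inj₂ l-min)) =
        trans (cong (λ x → 𝟙ℚ (adj G k l) * (excess (ℕtoℚ δ) k * x)) (excess-δ≡0 l-min))
              (a*[b*0]≡0 (𝟙ℚ (adj G k l)) (excess (ℕtoℚ δ) k))

  module _ (bipartite : ∀ i j → adj G i j ≡ adj G zero i xor adj G zero j) where
    open BipartiteGraph G (adj G zero) bipartite using (#true; #false; #false+#true≡d; deg-true)

    bipartite-regular⇒d≡2δ : Regular → suc n ≡ 2 ℕ.* δ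
    bipartite-regular⇒d≡2δ regular with deg>0⇒edge G zero (subst (0 ℕ.<_) (sym (regular zero)) (ℕ.≤-trans (s≤s z≤n) δ≥2))
    ... | v , 0v = begin
      suc n                ≡⟨ sym #false+#true≡d ⟩
      #false ℕ.+ #true     ≡⟨ cong₂ ℕ._+_ (trans (sym (deg-true 0v)) (regular v))
                                          (trans (sym (count-allFin (adj G zero))) (regular zero)) ⟩
      δ ℕ.+ δ              ≡⟨ cong (δ ℕ.+_) (sym (ℕ.+-identityʳ δ)) ⟩
      2 ℕ.* δ              ∎
      where open ≡-Reasoning

    bipartite⇒balanced : gap (ℕtoℚ δ) (ℕtoℚ ω) ≡ 0ℚ → IsCompleteBipartiteBalanced G δ
    bipartite⇒balanced gap≡0 = bipartite-regular⇒d≡2δ regular , adj G zero , regular zero , bipartite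
      where
      regular : Regular
      regular = gap≡0⇒Q≡0⇒regular gap≡0 (bipartite⇒Q≡0 (adj G zero) bipartite)

  0≤gap-δ-ω : 0ℚ ≤ gap (ℕtoℚ δ) (ℕtoℚ ω)
  0≤gap-δ-ω = 0≤gap (ℕtoℚ δ) (ℕtoℚ ω) ω>0 ℚ.≤-refl ℚ.≤-refl

  c4≡bound⇒Slack≡0 : ℕtoℚ (c4 G) ≡ c4Bound G (ℕtoℚ δ) (ℕtoℚ ω) → Slack ≡ 0
  c4≡bound⇒Slack≡0 c4≡bound = ℕtoℚ-injective {Slack} {0} (trans Slackℚ≡0 (sym ℕtoℚ-0))
    where
    Slackℚ≡0 : ℕtoℚ Slack ≡ 0ℚ
    Slackℚ≡0 = nonNeg+nonNeg≡0⇒≡0 (0≤ℕtoℚ Slack) 0≤gap-δ-ω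
      (trans (ℚ.+-comm (ℕtoℚ Slack) (gap (ℕtoℚ δ) (ℕtoℚ ω))) (c4≡c4Bound⇒gap+Slack≡0 (ℕtoℚ δ) (ℕtoℚ ω) c4≡bound))

  c4≡bound⇒gap≡0 : ℕtoℚ (c4 G) ≡ c4Bound G (ℕtoℚ δ) (ℕtoℚ ω) → gap (ℕtoℚ δ) (ℕtoℚ ω) ≡ 0ℚ
  c4≡bound⇒gap≡0 c4≡bound =
    nonNeg+nonNeg≡0⇒≡0 0≤gap-δ-ω (0≤ℕtoℚ Slack) (c4≡c4Bound⇒gap+Slack≡0 (ℕtoℚ δ) (ℕtoℚ ω) c4≡bound)

  equality⇒extremal : ℕtoℚ (c4 G) ≡ c4Bound G (ℕtoℚ δ) (ℕtoℚ ω) →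
                      IsComplete G ⊎ ∃[ m ] IsCompleteBipartiteBalanced G m
  equality⇒extremal c4≡bound =
    Sum.map₂ (λ bipartite → δ , bipartite⇒balanced bipartite (c4≡bound⇒gap≡0 c4≡bound))
             (complete-or-bipartite G (proj₁ dominate×adjacent) (proj₂ dominate×adjacent) zero)
    where
    dominate×adjacent = Slack≡0⇒dominate×adjacent (c4≡bound⇒Slack≡0 c4≡bound)

  extremal⇒dominate×adjacent×regular : IsComplete G ⊎ ∃[ m ] IsCompleteBipartiteBalanced G m →
                                       EdgesDominate G × EdgeNeighbourhoodsAdjacent G × Regular
  extremal⇒dominate×adjacent×regular (inj₁ complete) = complete⇒dominate , complete⇒adjacent , regular
    where
    open CompleteGraph G complete
    regular : Regular
    regular i with minDeg-attained G
    ... | w , δ≡dw = trans (deg-complete i) (sym (trans δ≡dw (deg-complete w)))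
  extremal⇒dominate×adjacent×regular (inj₂ (m , d≡2m , side , #side≡m , bipartite)) =
    bipartite⇒dominate , bipartite⇒adjacent , regular
    where
    open BipartiteGraph G side bipartite
    #true≡m : #true ≡ m
    #true≡m = trans (sym (count-allFin side)) #side≡m
    #false≡m : #false ≡ m
    #false≡m = ℕ.+-cancelʳ-≡ m #false m (begin
      #false ℕ.+ m      ≡⟨ cong (#false ℕ.+_) (sym #true≡m) ⟩
      #false ℕ.+ #true  ≡⟨ #false+#true≡d ⟩
      suc n             ≡⟨ d≡2m ⟩
      2 ℕ.* m           ≡⟨ cong (m ℕ.+_) (ℕ.+-identityʳ m) ⟩
      m ℕ.+ m           ∎)
      where open ≡-Reasoning
    deg≡m : ∀ i → deg G i ≡ m
    deg≡m i = by-side (side i) refl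
      where
      by-side : ∀ b → side i ≡ b → deg G i ≡ m
      by-side true  i-true  = trans (deg-true i-true) #false≡m
      by-side false i-false = trans (deg-false i-false) #true≡m
    regular : Regular
    regular i with minDeg-attained G
    ... | w , δ≡dw = trans (deg≡m i) (sym (trans δ≡dw (deg≡m w)))

  extremal⇒equality : IsComplete G ⊎ ∃[ m ] IsCompleteBipartiteBalanced G m →
                      ℕtoℚ (c4 G) ≡ c4Bound G (ℕtoℚ δ) (ℕtoℚ ω)
  extremal⇒equality extremal = gap+Slack≡0⇒c4≡c4Bound (ℕtoℚ δ) (ℕtoℚ ω) (begin
    gap (ℕtoℚ δ) (ℕtoℚ ω) + ℕtoℚ Slack   ≡⟨ cong₂ _+_ (regular⇒gap≡0 regular) (trans (cong ℕtoℚ Slack≡0) ℕtoℚ-0) ⟩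
    0ℚ + 0ℚ                              ≡⟨ ℚ.+-identityˡ 0ℚ ⟩
    0ℚ                                   ∎)
    where
    open ≡-Reasoning
    properties = extremal⇒dominate×adjacent×regular extremal
    regular = proj₂ (proj₂ properties)
    Slack≡0 : Slack ≡ 0
    Slack≡0 = dominate×adjacent⇒Slack≡0 (proj₁ properties) (proj₁ (proj₂ properties))

  inequality : ∀ α β → α ≤ ℕtoℚ δ → ℕtoℚ ω ≤ β → ℕtoℚ (c4 G) ≤ c4Bound G α β
  inequality α β = c4≤c4Bound α β ω>0

  c4≡c4Bound⇔extremal : ℕtoℚ (c4 G) ≡ c4Bound G (ℕtoℚ δ) (ℕtoℚ ω) ⇔ (IsComplete G ⊎ ∃[ m ] IsCompleteBipartiteBalanced G m)
  c4≡c4Bound⇔extremal = mk⇔ equality⇒extremal extremal⇒equality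

theorem2p2 : ∀ {d : ℕ} (G : Graph d) → Connected G → 2 ≤ℕ minDeg G →
    ∀ (ω : ℕ) → IsCliqueNumber G ω →
      ((α β : ℚ) → ℕtoℚ 2 ≤ α → α ≤ ℕtoℚ (minDeg G) → ℕtoℚ ω ≤ β →
        ℕtoℚ (c4 G) ≤ c4Bound G α β)
    × (ℕtoℚ (c4 G) ≡ c4Bound G (ℕtoℚ (minDeg G)) (ℕtoℚ ω)
        ⇔ (IsComplete G ⊎ ∃[ m ] IsCompleteBipartiteBalanced G m))
theorem2p2 {zero}  G _ () _ _
theorem2p2 {suc n} G _ δ≥2 ω ω-clique-number =
  (λ α β _ → inequality G δ≥2 ω ω-clique-number α β) , c4≡c4Bound⇔extremal G δ≥2 ω ω-clique-number
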